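{- Let $r \geq 1$ and let $G = G(r)$, i.e. $G$ is obtained from an $n$-clique cycle $\mathrm{CC}(B_1,\dots,B_n)$ ($n\ge3$) with connecting vertices $x_1,\dots,x_n$ by choosing a nonempty subset $A \subseteq \{x_1,\dots,x_n\}$ and attaching to each $x \in A$ a star-clique graph $\mathrm{SC}(x)$ centered at $x$, such that $|V(\mathrm{SC}(x))| \geq r+1$ for at least one $x \in A$. Then the $r$-independence complex $\mathrm{Ind}_r(G)$ is shellable.
   Context: All graphs are finite and simple. An $n$-clique cycle $\mathrm{CC}(B_1,\dots,B_n)$, $n\ge 3$, is a graph formed by a cyclic sequence of cliques $B_1,\dots,B_n$ in which each consecutive pair $B_i, B_{i+1}$ (indices modulo $n$) intersects in exactly one vertex $x_i$ (so $B_n$ and $B_1$ share $x_n$); the $x_1,\dots,x_n$ are the connecting vertices. A star-clique graph $\mathrm{SC}(x)$ is a graph formed by attaching a collection of cliques (complete graphs, possibly of different sizes) to a central vertex $x$, i.e. each clique contains $x$ and they share no other vertices; the attached star-cliques have vertices other than their center new and pairwise disjoint. For $r \geq 1$, a subset $A' \subseteq V(G)$ is $r$-independent if every connected component of $G[A']$ has at most $r$ vertices; $\mathrm{Ind}_r(G)$ is the simplicial complex on $V(G)$ of all $r$-independent subsets. A (not necessarily pure) simplicial complex is shellable if its facets can be ordered $F_1,\dots,F_t$ so that for each $k>1$, $\langle F_k\rangle \cap \langle F_1,\dots,F_{k-1}\rangle$ is pure of dimension $\dim F_k-1$ ($\langle\mathcal F\rangle$ = complex generated by $\mathcal F$). 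-}

module Defs where

open import Data.Nat using (ℕ; zero; suc; _≤_; _∸_; _<_)
open import Data.Fin using (Fin; toℕ)
open import Data.Fin.Subset using (Subset; _∈_; _∉_; _⊆_; _∩_; _∪_; ⁅_⁆; ∣_∣; ⋃; Nonempty)
  renaming (⊥ to ∅)
open import Data.List using (List; tabulate)
open import Data.Product using (Σ; ∃; _×_; proj₁)
open import Data.Sum using (_⊎_)
open import Relation.Nullary using (¬_)
open import Relation.Binary.PropositionalEquality using (_≡_; _≢_)

record Graph : Set₁ where
  field
    N   : ℕ
    Adj : Fin N → Fin N → Set

data Reach (G : Graph) (S : Subset (Graph.N G)) : Fin (Graph.N G) → Fin (Graph.N G) → Set where
  here : ∀ {u} → u ∈ S → Reach G S u u
  step : ∀ {u w v} → u ∈ S → Graph.Adj G u w → Reach G S w v → Reach G S u v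

-- S is r-independent: every connected component of G[S] has at most r vertices.
-- (The component of v in G[S] has ≤ r vertices iff every set of vertices
-- lying in that component has ≤ r elements.)
RIndependent : (r : ℕ) (G : Graph) → Subset (Graph.N G) → Set
RIndependent r G S =
  ∀ v → v ∈ S → ∀ (T : Subset (Graph.N G)) → (∀ w → w ∈ T → Reach G S v w) → ∣ T ∣ ≤ r

Ind : (r : ℕ) (G : Graph) → Subset (Graph.N G) → Set
Ind r G = RIndependent r G

IsFacet : ∀ {N} → (Subset N → Set) → Subset N → Set
IsFacet Δ F = Δ F × (∀ σ → Δ σ → F ⊆ σ → σ ≡ F)

PureCard : ∀ {N} → (Subset N → Set) → ℕ → Set
PureCard Δ m = ∀ σ → IsFacet Δ σ → ∣ σ ∣ ≡ m

PrefixIntersection : ∀ {N t} → (Fin t → Subset N) → Fin t → Subset N → Set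
PrefixIntersection F k σ = σ ⊆ F k × ∃ λ j → toℕ j < toℕ k × σ ⊆ F j

record Shelling {N : ℕ} (Δ : Subset N → Set) : Set where
  field
    t        : ℕ
    F        : Fin t → Subset N
    injective : ∀ i j → F i ≡ F j → i ≡ j
    facets    : ∀ i → IsFacet Δ (F i)
    complete  : ∀ σ → IsFacet Δ σ → ∃ λ i → F i ≡ σ
    shell     : ∀ k → 0 < toℕ k → PureCard (PrefixIntersection F k) (∣ F k ∣ ∸ 1)

Shellable : ∀ {N : ℕ} → (Subset N → Set) → Set
Shellable Δ = Shelling Δ

Consec : ∀ {n} → Fin n → Fin n → Set
Consec {n} i j = (suc (toℕ i) ≡ toℕ j) ⊎ (suc (toℕ i) ≡ n × toℕ j ≡ 0)

-- Data of G(r): an n-clique cycle CC(B_0,…,B_{n-1}) on Fin N with connecting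
-- vertices x_i ∈ B_i ∩ B_{i+1}, a nonempty index set A ⊆ {0..n-1}, and for
-- each i ∈ A a star-clique graph SC(x_i) consisting of cliques
-- SC (i , a), a < k i, all containing x_i.
record GrData (r : ℕ) : Set where
  field
    N : ℕ
    n : ℕ
    n≥3 : 3 ≤ n
    B : Fin n → Subset N
    x : Fin n → Fin N
    x-injective : ∀ i j → x i ≡ x j → i ≡ j
    consec-meet : ∀ i j → Consec i j → B i ∩ B j ≡ ⁅ x i ⁆
    nonconsec-disjoint : ∀ i j → i ≢ j → ¬ Consec i j → ¬ Consec j i → B i ∩ B j ≡ ∅
    A : Subset n
    A-nonempty : Nonempty A
    k : Fin n → ℕ
    k-outside-A : ∀ i → i ∉ A → k i ≡ 0
    SC : Σ (Fin n) (λ i → Fin (k i)) → Subset N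
    SC-center : ∀ p → x (proj₁ p) ∈ SC p
    SC-new : ∀ p → SC p ∩ ⋃ (tabulate B) ⊆ ⁅ x (proj₁ p) ⁆
    SC-disjoint : ∀ p q → p ≢ q → SC p ∩ SC q ⊆ ⁅ x (proj₁ p) ⁆
    covers : ∀ v → (∃ λ i → v ∈ B i) ⊎ (∃ λ p → v ∈ SC p)

  starVertices : Fin n → Subset N
  starVertices i = ⁅ x i ⁆ ∪ ⋃ (tabulate (λ (a : Fin (k i)) → SC (i Data.Product., a)))

  field
    big-star : ∃ λ i → i ∈ A × suc r ≤ ∣ starVertices i ∣

  graph : Graph
  graph = record
    { N = N
    ; Adj = λ u v → u ≢ v × ((∃ λ i → u ∈ B i × v ∈ B i) ⊎ (∃ λ p → u ∈ SC p × v ∈ SC p))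
    }

module Submission where

-- Ind_r(G) is vertex decomposable.  A stage of the decomposition is a pair C ⊆ H (linked
-- vertices, vertices not yet deleted); it needs a free vertex u such that every face F with
-- u ∈ F can trade u for some w ∈ H \ F, unless H itself is a face.
-- Let x be the centre of a star S with more than r vertices.  First u = x works, since S ⊈ F.
-- If x is linked, any vertex outside S joined to x through C works, again trading for a
-- vertex of S.  This ends with x deleted, or with the component of x inside C ∪ S, where
-- S serves as long as that component has more than r vertices.  The rest of the graph is a
-- block graph, rooted by cutting the cycle at x.  In it take a clique whose members have
-- together more than r descendants, as deep as possible, and among its topmost free
-- descendants take u with the largest subtree.  If the subtree of u is not contained in F,
-- trade u for a vertex w of it, whose new component lies below u; otherwise trade u for some
-- missing w under another such vertex, which costs the component at most as many vertices
-- as the loss of the subtree of u saves.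

open import Defs
open import Data.Bool.Properties using (T-≡)
open import Data.Empty using (⊥)
open import Data.Fin using (Fin; zero; suc; toℕ; _≟_; fromℕ<)
open import Data.Fin.Properties using (any?; all?; toℕ-injective; toℕ<n; toℕ-fromℕ<)
open import Data.Fin.Subset
  using (Subset; inside; outside; _∈_; _∉_; _⊆_; _∩_; _∪_; _─_; _-_; ⁅_⁆; ∣_∣; ⋃; ⊤)
  renaming (⊥ to ∅)
open import Data.Fin.Subset.Properties
open import Data.List using (List; []; _∷_; _++_; length; lookup) renaming (tabulate to tabulateˡ)
import Data.List.Membership.Propositional as Mem
open import Data.List.Membership.Propositional.Properties using (∈-++⁺ˡ; ∈-++⁺ʳ; ∈-++⁻; ∈-lookup)
import Data.List.Relation.Unary.Any as Any
import Data.List.Relation.Unary.Any.Properties as Any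
open import Data.Nat using (ℕ; zero; suc; _+_; _∸_; _≤_; _<_; z≤n; s≤s; s≤s⁻¹; _≤?_; _<?_)
open import Data.Nat.Induction using (<-wellFounded)
open import Data.Nat.Properties renaming (_≟_ to _≟ⁿ_)
open import Data.Product using (Σ; ∃; _×_; _,_; proj₁; proj₂)
import Data.Product.Properties as Product
open import Data.Sum using (_⊎_; inj₁; inj₂; [_,_]′; map₁; map₂)
import Data.Sum.Properties as Sum
open import Data.Vec using ([]; _∷_; tabulate; here; there)
open import Data.Vec.Properties using (lookup∘tabulate; lookup⇒[]=; []=⇒lookup)
open import Function using (_∘_; Equivalence)
open import Induction.WellFounded using (Acc; acc)
open import Relation.Binary.PropositionalEquality using (_≡_; _≢_; refl; sym; trans; cong; subst; module ≡-Reasoning)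
open import Relation.Nullary using (¬_; Dec; yes; no; contradiction)
open import Relation.Nullary.Decidable
  using (⌊_⌋; map′; ¬?; _×-dec_; _⊎-dec_; _→-dec_; toWitness; fromWitness; decidable-stable)
open import Relation.Unary using (Decidable)

private
  variable
    m : ℕ

-- Finite subsets

comprehension : {P : Fin m → Set} → Decidable P → Subset m
comprehension P? = tabulate (λ v → ⌊ P? v ⌋)

module _ {P : Fin m → Set} (P? : Decidable P) where

  ∈-comprehension⁺ : ∀ {v} → P v → v ∈ comprehension P?
  ∈-comprehension⁺ {v} pv = lookup⇒[]= v _
    (trans (lookup∘tabulate _ v) (Equivalence.to T-≡ (fromWitness pv)))

  ∈-comprehension⁻ : ∀ {v} → v ∈ comprehension P? → P v
  ∈-comprehension⁻ {v} v∈ = toWitness (Equivalence.from T-≡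
    (trans (sym (lookup∘tabulate _ v)) ([]=⇒lookup v∈)))

x∈p─q⇒x∉q : ∀ (p q : Subset m) {v} → v ∈ p ─ q → v ∉ q
x∈p─q⇒x∉q (inside ∷ p) (outside ∷ q) here ()
x∈p─q⇒x∉q (s ∷ p) (t ∷ q) (there v∈) (there v∈q) = x∈p─q⇒x∉q p q v∈ v∈q

x∉p-x : ∀ (p : Subset m) {v} → v ∉ p - v
x∉p-x p v∈ = x∈p─q⇒x∉q p _ v∈ (x∈⁅x⁆ _)

x∈p-y⇒x≢y : ∀ (p : Subset m) {v w} → v ∈ p - w → v ≢ w
x∈p-y⇒x≢y p v∈ refl = x∉p-x p v∈

p-x⊆p : ∀ (p : Subset m) v → p - v ⊆ p
p-x⊆p p v = p─q⊆p p ⁅ v ⁆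

∣p∪q∣≤∣p∣+∣q∣ : ∀ (p q : Subset m) → ∣ p ∪ q ∣ ≤ ∣ p ∣ + ∣ q ∣
∣p∪q∣≤∣p∣+∣q∣ [] [] = z≤n
∣p∪q∣≤∣p∣+∣q∣ (inside ∷ p) (inside ∷ q) =
  s≤s (≤-trans (∣p∪q∣≤∣p∣+∣q∣ p q) (+-monoʳ-≤ ∣ p ∣ (n≤1+n _)))
∣p∪q∣≤∣p∣+∣q∣ (inside ∷ p) (outside ∷ q) = s≤s (∣p∪q∣≤∣p∣+∣q∣ p q)
∣p∪q∣≤∣p∣+∣q∣ (outside ∷ p) (inside ∷ q) =
  ≤-trans (s≤s (∣p∪q∣≤∣p∣+∣q∣ p q)) (≤-reflexive (sym (+-suc ∣ p ∣ ∣ q ∣)))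
∣p∪q∣≤∣p∣+∣q∣ (outside ∷ p) (outside ∷ q) = ∣p∪q∣≤∣p∣+∣q∣ p q

q⊆p⇒∣p─q∣+∣q∣≡∣p∣ : ∀ (p q : Subset m) → q ⊆ p → ∣ p ─ q ∣ + ∣ q ∣ ≡ ∣ p ∣
q⊆p⇒∣p─q∣+∣q∣≡∣p∣ [] [] _ = refl
q⊆p⇒∣p─q∣+∣q∣≡∣p∣ (inside ∷ p) (inside ∷ q) q⊆p =
  trans (+-suc ∣ p ─ q ∣ ∣ q ∣) (cong suc (q⊆p⇒∣p─q∣+∣q∣≡∣p∣ p q (drop-∷-⊆ q⊆p)))
q⊆p⇒∣p─q∣+∣q∣≡∣p∣ (inside ∷ p) (outside ∷ q) q⊆p = cong suc (q⊆p⇒∣p─q∣+∣q∣≡∣p∣ p q (drop-∷-⊆ q⊆p))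
q⊆p⇒∣p─q∣+∣q∣≡∣p∣ (outside ∷ p) (inside ∷ q) q⊆p = contradiction (q⊆p here) λ ()
q⊆p⇒∣p─q∣+∣q∣≡∣p∣ (outside ∷ p) (outside ∷ q) q⊆p = q⊆p⇒∣p─q∣+∣q∣≡∣p∣ p q (drop-∷-⊆ q⊆p)

x∈p⇒∣p-x∣≡∣p∣∸1 : ∀ (p : Subset m) {v} → v ∈ p → ∣ p - v ∣ ≡ ∣ p ∣ ∸ 1
x∈p⇒∣p-x∣≡∣p∣∸1 p {v} v∈p = begin
  ∣ p - v ∣                     ≡⟨ m+n∸n≡m ∣ p - v ∣ 1 ⟨
  ∣ p - v ∣ + 1 ∸ 1             ≡⟨ cong (λ c → ∣ p - v ∣ + c ∸ 1) (∣⁅x⁆∣≡1 v) ⟨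
  ∣ p - v ∣ + ∣ ⁅ v ⁆ ∣ ∸ 1     ≡⟨ cong (_∸ 1) (q⊆p⇒∣p─q∣+∣q∣≡∣p∣ p ⁅ v ⁆ ⁅v⁆⊆p) ⟩
  ∣ p ∣ ∸ 1                     ∎
  where
  open ≡-Reasoning
  ⁅v⁆⊆p : ⁅ v ⁆ ⊆ p
  ⁅v⁆⊆p w∈ = subst (_∈ p) (sym (x∈⁅y⁆⇒x≡y v w∈)) v∈p

∣p-x∪⁅y⁆∣≤∣p∣ : ∀ (p : Subset m) {v} w → v ∈ p → ∣ (p - v) ∪ ⁅ w ⁆ ∣ ≤ ∣ p ∣
∣p-x∪⁅y⁆∣≤∣p∣ p {v} w v∈p = begin
  ∣ (p - v) ∪ ⁅ w ⁆ ∣     ≤⟨ ∣p∪q∣≤∣p∣+∣q∣ (p - v) ⁅ w ⁆ ⟩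
  ∣ p - v ∣ + ∣ ⁅ w ⁆ ∣   ≡⟨ cong (∣ p - v ∣ +_) (∣⁅x⁆∣≡1 w) ⟩
  ∣ p - v ∣ + 1           ≡⟨ +-comm ∣ p - v ∣ 1 ⟩
  suc ∣ p - v ∣           ≤⟨ x∈p⇒∣p-x∣<∣p∣ v∈p ⟩
  ∣ p ∣                   ∎
  where open ≤-Reasoning

⊈⇒∃ : ∀ (p q : Subset m) → ¬ p ⊆ q → ∃ λ v → v ∈ p × v ∉ q
⊈⇒∃ p q p⊈q with any? (λ v → (v ∈? p) ×-dec ¬? (v ∈? q))
... | yes w = w
... | no ∄ = contradiction (λ {v} v∈p → decidable-stable (v ∈? q) (λ v∉q → ∄ (v , v∈p , v∉q))) p⊈q

∪⁅⁆-⊆ : ∀ {p q : Subset m} {v} → p ⊆ q → v ∈ q → p ∪ ⁅ v ⁆ ⊆ q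
∪⁅⁆-⊆ {p = p} {q} {v} p⊆q v∈q w∈ with x∈p∪q⁻ p ⁅ v ⁆ w∈
... | inj₁ w∈p = p⊆q w∈p
... | inj₂ w∈v = subst (_∈ q) (sym (x∈⁅y⁆⇒x≡y v w∈v)) v∈q

∈-∪⁅⁆⁻ : ∀ (p : Subset m) {v w} → w ∈ p ∪ ⁅ v ⁆ → w ∈ p ⊎ w ≡ v
∈-∪⁅⁆⁻ p {v} w∈ = map₂ (x∈⁅y⁆⇒x≡y v) (x∈p∪q⁻ p ⁅ v ⁆ w∈)

y∈p∪⁅y⁆ : ∀ (p : Subset m) v → v ∈ p ∪ ⁅ v ⁆
y∈p∪⁅y⁆ p v = x∈p∪q⁺ (inj₂ (x∈⁅x⁆ v))

∪⁅⁆-monoˡ-⊆ : ∀ {p q : Subset m} v → p ⊆ q → p ∪ ⁅ v ⁆ ⊆ q ∪ ⁅ v ⁆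
∪⁅⁆-monoˡ-⊆ {q = q} v p⊆q = ∪⁅⁆-⊆ (λ w∈ → p⊆p∪q ⁅ v ⁆ (p⊆q w∈)) (y∈p∪⁅y⁆ q v)

⊆∧∌⇒⊆- : ∀ {p q : Subset m} {v} → p ⊆ q → v ∉ p → p ⊆ q - v
⊆∧∌⇒⊆- p⊆q v∉p w∈p = x∈p∧x≢y⇒x∈p-y (p⊆q w∈p) λ { refl → v∉p w∈p }

∈-⋃-tabulate⁻ : ∀ {k} (f : Fin k → Subset m) {v} → v ∈ ⋃ (tabulateˡ f) → ∃ λ i → v ∈ f i
∈-⋃-tabulate⁻ {k = zero} f v∈ = contradiction v∈ ∉⊥
∈-⋃-tabulate⁻ {k = suc k} f v∈ with x∈p∪q⁻ (f zero) _ v∈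
... | inj₁ v∈f0 = zero , v∈f0
... | inj₂ v∈⋃ with ∈-⋃-tabulate⁻ (f ∘ suc) v∈⋃
...   | i , v∈fi = suc i , v∈fi

∈-⋃-tabulate⁺ : ∀ {k} (f : Fin k → Subset m) {v} i → v ∈ f i → v ∈ ⋃ (tabulateˡ f)
∈-⋃-tabulate⁺ f zero v∈ = x∈p∪q⁺ (inj₁ v∈)
∈-⋃-tabulate⁺ f (suc i) v∈ = x∈p∪q⁺ (inj₂ (∈-⋃-tabulate⁺ (f ∘ suc) i v∈))

argmin : {P : Fin m → Set} → Decidable P → (f : Fin m → ℕ) → ∃ P → ∃ λ v → P v × ∀ w → P w → f v ≤ f w
argmin {P = P} P? f (v , pv) = go v pv (<-wellFounded (f v))
  where
  go : ∀ v → P v → Acc _<_ (f v) → ∃ λ v → P v × ∀ w → P w → f v ≤ f w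
  go v pv (acc rs) with any? (λ w → P? w ×-dec (f w <? f v))
  ... | yes (w , pw , fw<fv) = go w pw (rs fw<fv)
  ... | no ∄ = v , pv , λ w pw → ≮⇒≥ (λ fw<fv → ∄ (w , pw , fw<fv))

-- Vertex decompositions

-- The complex decomposed at a stage (C , H) consists of the faces F with C ⊆ F ⊆ H:
-- the vertices outside H have been deleted, and those in C have been linked.
Sheds : (Subset m → Set) → (C H : Subset m) → Fin m → Set
Sheds Δ C H u = ∀ F → Δ F → C ⊆ F → F ⊆ H → u ∈ F → ∃ λ w → w ∈ H × w ∉ F × Δ ((F - u) ∪ ⁅ w ⁆)

module Shedding {N : ℕ} (Δ : Subset N → Set) (Δ? : Decidable Δ)
                (Δ-⊆ : ∀ {F F′} → F ⊆ F′ → Δ F′ → Δ F) where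

  open Mem using () renaming (_∈_ to _∈ˡ_; _∉_ to _∉ˡ_)

  -- Adding single vertices suffices to test maximality, because `Δ` is closed under subsets.
  record Facet (C H F : Subset N) : Set where
    constructor facet
    field
      face     : Δ F
      C⊆F      : C ⊆ F
      F⊆H      : F ⊆ H
      maximal  : ∀ {v} → v ∈ H → Δ (F ∪ ⁅ v ⁆) → v ∈ F

  -- With `P` the set of earlier facets, this is the shelling condition in exchange form: `F ∩ F′`
  -- lies in the ridge `F - v`, which an earlier facet `F″` contains.
  Attaches : (Subset N → Set) → Subset N → Set
  Attaches P F = ∀ F′ → P F′ → ∃ λ F″ → P F″ × ∃ λ v → v ∈ F × v ∉ F′ × F - v ⊆ F″

  -- `P` collects the facets that precede the list. The clause `¬ P F` keeps facets from repeating
  -- and later yields injectivity.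
  data ShellingList (P : Subset N → Set) : List (Subset N) → Set₁ where
    []  : ShellingList P []
    _∷_ : ∀ {F L} → (¬ P F × Attaches P F) → ShellingList (λ F′ → P F′ ⊎ F′ ≡ F) L → ShellingList P (F ∷ L)

  record Decomposition (C H : Subset N) : Set₁ where
    field
      list     : List (Subset N)
      sound    : ∀ {F} → F ∈ˡ list → Facet C H F
      complete : ∀ {F} → Facet C H F → F ∈ˡ list
      shelling : ShellingList (λ _ → ⊥) list

  extend : ∀ {C H F} → Δ F → C ⊆ F → F ⊆ H → ∃ λ F′ → F ⊆ F′ × Facet C H F′
  extend {C} {H} {F} = go F (<-wellFounded (∣ H ∣ ∸ ∣ F ∣))
    where
    go : ∀ F → Acc _<_ (∣ H ∣ ∸ ∣ F ∣) → Δ F → C ⊆ F → F ⊆ H → ∃ λ F′ → F ⊆ F′ × Facet C H F′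
    go F (acc rs) δ C⊆F F⊆H with any? (λ v → (v ∈? H) ×-dec Δ? (F ∪ ⁅ v ⁆) ×-dec ¬? (v ∈? F))
    ... | no ∄ = F , (λ v∈ → v∈) , facet δ C⊆F F⊆H
          (λ {v} v∈H δ′ → decidable-stable (v ∈? F) (λ v∉F → ∄ (v , v∈H , δ′ , v∉F)))
    ... | yes (v , v∈H , δ′ , v∉F)
      with go (F ∪ ⁅ v ⁆) (rs (∸-monoʳ-< (p⊂q⇒∣p∣<∣q∣ (p⊆p∪q ⁅ v ⁆ , v , y∈p∪⁅y⁆ F v , v∉F))
                                (p⊆q⇒∣p∣≤∣q∣ (∪⁅⁆-⊆ F⊆H v∈H))))
              δ′ (λ w∈ → p⊆p∪q ⁅ v ⁆ (C⊆F w∈)) (∪⁅⁆-⊆ F⊆H v∈H)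
    ...   | F′ , F⊆F′ , φ = F′ , (λ w∈ → F⊆F′ (p⊆p∪q ⁅ v ⁆ w∈)) , φ

  ShellingList-resp : ∀ {P Q L} → (∀ {F} → P F → Q F) → (∀ {F} → Q F → P F) →
                      ShellingList P L → ShellingList Q L
  ShellingList-resp p→q q→p [] = []
  ShellingList-resp {P} {Q} p→q q→p ((¬p , att) ∷ sh) =
    (¬p ∘ q→p , λ F′ q → let F″ , p″ , rest = att F′ (q→p q) in F″ , p→q p″ , rest)
    ∷ ShellingList-resp (map₁ p→q) (map₁ q→p) sh

  -- Attachment treats each earlier facet separately, so facets put in front of a shelling do no
  -- harm once every facet of the list attaches to them.
  ShellingList-⊎ : ∀ {P Q L} → (∀ {F} → F ∈ˡ L → ¬ Q F × Attaches Q F) →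
                   ShellingList P L → ShellingList (λ F → Q F ⊎ P F) L
  ShellingList-⊎ cross [] = []
  ShellingList-⊎ {P} {Q} {F ∷ L} cross ((¬p , att) ∷ sh) =
    ([ proj₁ (cross (Any.here refl)) , ¬p ]′ , attaches)
    ∷ ShellingList-resp assocʳ assocˡ (ShellingList-⊎ (cross ∘ Any.there) sh)
    where
    attaches : Attaches (λ F → Q F ⊎ P F) F
    attaches F′ (inj₁ q) = let F″ , q″ , rest = proj₂ (cross (Any.here refl)) F′ q in F″ , inj₁ q″ , rest
    attaches F′ (inj₂ p) = let F″ , p″ , rest = att F′ p in F″ , inj₂ p″ , rest
    assocʳ : ∀ {A B C : Set} → A ⊎ (B ⊎ C) → (A ⊎ B) ⊎ C
    assocʳ = [ inj₁ ∘ inj₁ , map₁ inj₂ ]′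
    assocˡ : ∀ {A B C : Set} → (A ⊎ B) ⊎ C → A ⊎ (B ⊎ C)
    assocˡ = [ map₂ inj₁ , inj₂ ∘ inj₂ ]′

  ShellingList-++ : ∀ {P L L′} → ShellingList P L → ShellingList (λ F → P F ⊎ F ∈ˡ L) L′ →
                    ShellingList P (L ++ L′)
  ShellingList-++ [] sh′ = ShellingList-resp (λ { (inj₁ p) → p ; (inj₂ ()) }) inj₁ sh′
  ShellingList-++ (c ∷ sh) sh′ = c ∷ ShellingList-++ sh
    (ShellingList-resp
      (λ { (inj₁ p) → inj₁ (inj₁ p) ; (inj₂ (Any.here e)) → inj₁ (inj₂ e) ; (inj₂ (Any.there m)) → inj₂ m })
      (λ { (inj₁ (inj₁ p)) → inj₁ p ; (inj₁ (inj₂ e)) → inj₂ (Any.here e) ; (inj₂ m) → inj₂ (Any.there m) })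
      sh′)

  nonface : ∀ {C H} → ¬ Δ C → Decomposition C H
  nonface ¬δ = record
    { list = []
    ; sound = λ ()
    ; complete = λ φ → contradiction (Δ-⊆ (Facet.C⊆F φ) (Facet.face φ)) ¬δ
    ; shelling = []
    }

  simplex : ∀ {C H} → C ⊆ H → Δ H → Decomposition C H
  simplex {C} {H} C⊆H δ = record
    { list = H ∷ []
    ; sound = λ { (Any.here refl) → facet δ C⊆H (λ v∈ → v∈) (λ v∈H _ → v∈H) }
    ; complete = λ φ → Any.here (⊆-antisym (Facet.F⊆H φ)
        (λ v∈H → Facet.maximal φ v∈H (Δ-⊆ (∪⁅⁆-⊆ (Facet.F⊆H φ) v∈H) δ)))
    ; shelling = ((λ ()) , λ _ ()) ∷ []
    }

  module _ {C H : Subset N} {u : Fin N} (u∈H : u ∈ H) (u∉C : u ∉ C) (sheds : Sheds Δ C H u)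
           (del : Decomposition C (H - u)) (link : Decomposition (C ∪ ⁅ u ⁆) H) where
    private
      module Del = Decomposition del
      module Link = Decomposition link

      del-facet : ∀ {F} → Facet C (H - u) F → Facet C H F
      del-facet {F} (facet δ C⊆F F⊆H-u max) = facet δ C⊆F F⊆H max′
        where
        F⊆H : F ⊆ H
        F⊆H = p-x⊆p H u ∘ F⊆H-u
        u∉F : u ∉ F
        u∉F = x∉p-x H ∘ F⊆H-u
        max′ : ∀ {v} → v ∈ H → Δ (F ∪ ⁅ v ⁆) → v ∈ F
        max′ {v} v∈H δ′ with v ≟ u
        ... | no v≢u = max (x∈p∧x≢y⇒x∈p-y v∈H v≢u) δ′
        ... | yes refl
          -- If `u` could be added to a facet of the deletion, the trade would give a vertex `w`
          -- that could be added instead, against maximality.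
          with sheds (F ∪ ⁅ u ⁆) δ′ (p⊆p∪q ⁅ u ⁆ ∘ C⊆F) (∪⁅⁆-⊆ F⊆H u∈H) (y∈p∪⁅y⁆ F u)
        ...   | w , w∈H , w∉Fu , δw =
          contradiction (p⊆p∪q ⁅ u ⁆ (max (x∈p∧x≢y⇒x∈p-y w∈H λ { refl → w∉Fu (y∈p∪⁅y⁆ F u) })
                          (Δ-⊆ (∪⁅⁆-monoˡ-⊆ w (⊆∧∌⇒⊆- (p⊆p∪q ⁅ u ⁆) u∉F)) δw)))
                        w∉Fu

      link-facet : ∀ {F} → Facet (C ∪ ⁅ u ⁆) H F → Facet C H F
      link-facet (facet δ Cu⊆F F⊆H max) = facet δ (Cu⊆F ∘ p⊆p∪q ⁅ u ⁆) F⊆H max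

      ∌-del : ∀ {F} → Facet C (H - u) F → u ∉ F
      ∌-del φ = x∉p-x H ∘ Facet.F⊆H φ

      ∋-link : ∀ {F} → Facet (C ∪ ⁅ u ⁆) H F → u ∈ F
      ∋-link φ = Facet.C⊆F φ (y∈p∪⁅y⁆ C u)

      -- Trading `u` for `w` puts `F - u` inside a facet of the deletion. All facets of the deletion
      -- miss `u`, so this one ridge serves against each of them.
      cross : ∀ {F} → F ∈ˡ Link.list → F ∉ˡ Del.list × Attaches (_∈ˡ Del.list) F
      cross {F} F∈ = (λ F∈′ → ∌-del (Del.sound F∈′) u∈F) , attaches
        where
        φ = Link.sound F∈
        u∈F = ∋-link φ
        attaches : Attaches (_∈ˡ Del.list) F
        attaches F′ F′∈ with sheds F (Facet.face φ) (Facet.C⊆F φ ∘ p⊆p∪q ⁅ u ⁆) (Facet.F⊆H φ) u∈F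
        ... | w , w∈H , w∉F , δ
          with extend {C} {H - u} δ
                 (p⊆p∪q ⁅ w ⁆ ∘ ⊆∧∌⇒⊆- (Facet.C⊆F φ ∘ p⊆p∪q ⁅ u ⁆) u∉C)
                 (∪⁅⁆-⊆ (λ v∈ → x∈p∧x≢y⇒x∈p-y (Facet.F⊆H φ (p-x⊆p F u v∈)) (x∈p-y⇒x≢y F v∈))
                        (x∈p∧x≢y⇒x∈p-y w∈H λ { refl → w∉F u∈F }))
        ...   | F″ , ⊆F″ , φ″ =
          F″ , Del.complete φ″ , u , u∈F , ∌-del (Del.sound F′∈) , ⊆F″ ∘ p⊆p∪q ⁅ w ⁆

      complete′ : ∀ {F} → Facet C H F → F ∈ˡ Del.list ++ Link.list
      complete′ {F} (facet δ C⊆F F⊆H max) with u ∈? F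
      ... | yes u∈F = ∈-++⁺ʳ Del.list (Link.complete (facet δ (∪⁅⁆-⊆ C⊆F u∈F) F⊆H max))
      ... | no u∉F = ∈-++⁺ˡ (Del.complete
              (facet δ C⊆F (⊆∧∌⇒⊆- F⊆H u∉F) (max ∘ p-x⊆p H u)))

    -- Facets without `u` are listed before those with `u`; the shedding condition makes the two
    -- lists fit together.
    shed : Decomposition C H
    shed = record
      { list = Del.list ++ Link.list
      ; sound = [ del-facet ∘ Del.sound , link-facet ∘ Link.sound ]′ ∘ ∈-++⁻ Del.list
      ; complete = complete′
      ; shelling = ShellingList-++ Del.shelling
          (ShellingList-resp (λ { (inj₁ m) → inj₂ m ; (inj₂ ()) }) (λ { (inj₂ m) → inj₁ m })
            (ShellingList-⊎ cross Link.shelling))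
      }

  module _ (Inv : Subset N → Subset N → Set)
           (next : ∀ {C H} → C ⊆ H → Δ C → Inv C H →
                   Δ H ⊎ ∃ λ u → u ∈ H × u ∉ C × Sheds Δ C H u × Inv C (H - u) × Inv (C ∪ ⁅ u ⁆) H) where

    -- `m` bounds the number of undecided vertices, those of `H` outside `C`; deleting or linking a
    -- vertex decides it.
    decompose : ∀ {C H} m → ∣ H ∣ ≤ m + ∣ C ∣ → C ⊆ H → Inv C H → Decomposition C H
    decompose {C} {H} m ∣H∣≤ C⊆H inv with Δ? C
    ... | no ¬δ = nonface ¬δ
    ... | yes δ with next C⊆H δ inv
    ...   | inj₁ δH = simplex C⊆H δH
    ...   | inj₂ (u , u∈H , u∉C , sheds , inv₁ , inv₂) with m
    ...     | zero = contradiction ∣H∣≤ (<⇒≱ (p⊂q⇒∣p∣<∣q∣ (C⊆H , u , u∈H , u∉C)))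
    ...     | suc m = shed u∈H u∉C sheds
                (decompose m (s≤s⁻¹ (≤-trans (x∈p⇒∣p-x∣<∣p∣ u∈H) ∣H∣≤)) (⊆∧∌⇒⊆- C⊆H u∉C) inv₁)
                (decompose m
                  (≤-trans ∣H∣≤ (≤-trans (≤-reflexive (sym (+-suc m ∣ C ∣)))
                    (+-monoʳ-≤ m (p⊂q⇒∣p∣<∣q∣ (p⊆p∪q ⁅ u ⁆ , u , y∈p∪⁅y⁆ C u , u∉C)))))
                  (∪⁅⁆-⊆ C⊆H u∈H) inv₂)

  -- From decompositions to shellings

  Earlier : (Subset N → Set) → (L : List (Subset N)) → Fin (length L) → Subset N → Set
  Earlier P L k F = P F ⊎ ∃ λ j → toℕ j < toℕ k × lookup L j ≡ F

  lookup-attaches : ∀ {P L} → ShellingList P L → ∀ k → Attaches (Earlier P L k) (lookup L k)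
  lookup-attaches ((_ , att) ∷ sh) zero F′ (inj₁ p) =
    let F″ , p″ , rest = att F′ p in F″ , inj₁ p″ , rest
  lookup-attaches {P} {F ∷ L} (c ∷ sh) (suc k) F′ e =
    let F″ , e″ , rest = lookup-attaches sh k F′ (shift e) in F″ , unshift e″ , rest
    where
    shift : ∀ {G} → Earlier P (F ∷ L) (suc k) G → Earlier (λ F′ → P F′ ⊎ F′ ≡ F) L k G
    shift (inj₁ p) = inj₁ (inj₁ p)
    shift (inj₂ (zero , _ , eq)) = inj₁ (inj₂ (sym eq))
    shift (inj₂ (suc j , j<k , eq)) = inj₂ (j , s≤s⁻¹ j<k , eq)
    unshift : ∀ {G} → Earlier (λ F′ → P F′ ⊎ F′ ≡ F) L k G → Earlier P (F ∷ L) (suc k) G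
    unshift (inj₁ (inj₁ p)) = inj₁ p
    unshift (inj₁ (inj₂ eq)) = inj₂ (zero , s≤s z≤n , sym eq)
    unshift (inj₂ (j , j<k , eq)) = inj₂ (suc j , s≤s j<k , eq)

  lookup-fresh : ∀ {P L} → ShellingList P L → ∀ k → ¬ P (lookup L k)
  lookup-fresh ((¬p , _) ∷ sh) zero = ¬p
  lookup-fresh (_ ∷ sh) (suc k) = lookup-fresh sh k ∘ inj₁

  lookup-injective : ∀ {P L} → ShellingList P L → ∀ i j → lookup L i ≡ lookup L j → i ≡ j
  lookup-injective (_ ∷ sh) zero zero eq = refl
  lookup-injective (_ ∷ sh) zero (suc j) eq = contradiction (inj₂ (sym eq)) (lookup-fresh sh j)
  lookup-injective (_ ∷ sh) (suc i) zero eq = contradiction (inj₂ eq) (lookup-fresh sh i)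
  lookup-injective (_ ∷ sh) (suc i) (suc j) eq = cong suc (lookup-injective sh i j eq)

  decomposition⇒shellable : Decomposition ∅ ⊤ → Shellable Δ
  decomposition⇒shellable d = record
    { t = length list
    ; F = lookup list
    ; injective = lookup-injective shelling
    ; facets = λ i → toFacet (sound (∈-lookup i))
    ; complete = λ σ φ → let m = complete (fromFacet φ) in Any.index m , sym (Any.lookup-index m)
    ; shell = λ k _ → pure k
    }
    where
    open Decomposition d
    toFacet : ∀ {F} → Facet ∅ ⊤ F → IsFacet Δ F
    toFacet {F} (facet δ _ _ max) = δ , λ σ δσ F⊆σ →
      ⊆-antisym (λ v∈σ → max ∈⊤ (Δ-⊆ (∪⁅⁆-⊆ F⊆σ v∈σ) δσ)) F⊆σ
    fromFacet : ∀ {F} → IsFacet Δ F → Facet ∅ ⊤ F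
    fromFacet {F} (δ , max) = facet δ ⊥⊆ ⊆⊤
      λ {v} _ δ′ → subst (v ∈_) (max _ δ′ (p⊆p∪q ⁅ v ⁆)) (y∈p∪⁅y⁆ F v)
    pure : ∀ k → PureCard (PrefixIntersection (lookup list) k) (∣ lookup list k ∣ ∸ 1)
    pure k σ ((σ⊆Fk , j , j<k , σ⊆Fj) , σ-max)
      with lookup-attaches shelling k (lookup list j) (inj₂ (j , j<k , refl))
    ... | F″ , inj₂ (i , i<k , refl) , v , v∈Fk , v∉Fj , Fk-v⊆Fi =
      -- `σ` misses `v`, so it lies in the ridge `lookup list k - v`, which is itself part of the
      -- intersection; maximality of `σ` makes the two equal.
      trans (cong ∣_∣ (sym (σ-max (lookup list k - v) (p-x⊆p (lookup list k) v , i , i<k , Fk-v⊆Fi)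
                                  (⊆∧∌⇒⊆- σ⊆Fk (v∉Fj ∘ σ⊆Fj)))))
            (x∈p⇒∣p-x∣≡∣p∣∸1 (lookup list k) v∈Fk)

-- Reachability and r-independence

module _ {G : Graph} where
  open Graph G

  reach-start : ∀ {S u v} → Reach G S u v → u ∈ S
  reach-start (here u∈S) = u∈S
  reach-start (step u∈S _ _) = u∈S

  reach-end : ∀ {S u v} → Reach G S u v → v ∈ S
  reach-end (here u∈S) = u∈S
  reach-end (step _ _ p) = reach-end p

  reach-trans : ∀ {S u v w} → Reach G S u v → Reach G S v w → Reach G S u w
  reach-trans (here _) q = q
  reach-trans (step u∈S a p) q = step u∈S a (reach-trans p q)

  reach-snoc : ∀ {S u v w} → Reach G S u v → Adj v w → w ∈ S → Reach G S u w
  reach-snoc p a w∈S = reach-trans p (step (reach-end p) a (here w∈S))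

  reach-mono : ∀ {S S′ u v} → S ⊆ S′ → Reach G S u v → Reach G S′ u v
  reach-mono S⊆S′ (here u∈S) = here (S⊆S′ u∈S)
  reach-mono S⊆S′ (step u∈S a p) = step (S⊆S′ u∈S) a (reach-mono S⊆S′ p)

  reach-closed : ∀ {S} (P : Fin N → Set) → (∀ {a b} → P a → Adj a b → a ∈ S → b ∈ S → P b) →
                 ∀ {u v} → P u → Reach G S u v → P v
  reach-closed P cl pu (here _) = pu
  reach-closed P cl pu (step u∈S a p) = reach-closed P cl (cl pu a u∈S (reach-start p)) p

  reach-sym : (∀ {u v} → Adj u v → Adj v u) → ∀ {S u v} → Reach G S u v → Reach G S v u
  reach-sym adj-sym (here u∈S) = here u∈S
  reach-sym adj-sym (step u∈S a p) = reach-snoc (reach-sym adj-sym p) (adj-sym a) u∈S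

  private
    -- Cutting a walk after its last visit to `u` leaves a tail in `S - u`; this lets `reach?`
    -- recurse on the size of `S`.
    last-visit : ∀ {S a v} u → Reach G S a v →
                 Reach G (S - u) a v ⊎ (u ≡ v ⊎ ∃ λ w → Adj u w × Reach G (S - u) w v)
    last-visit {a = a} u (here a∈S) with a ≟ u
    ... | yes refl = inj₂ (inj₁ refl)
    ... | no a≢u = inj₁ (here (x∈p∧x≢y⇒x∈p-y a∈S a≢u))
    last-visit {a = a} u (step a∈S e p) with last-visit u p
    ... | inj₂ q = inj₂ q
    ... | inj₁ q with a ≟ u
    ...   | yes refl = inj₂ (inj₂ (_ , e , q))
    ...   | no a≢u = inj₁ (step (x∈p∧x≢y⇒x∈p-y a∈S a≢u) e q)

  module _ (adj? : ∀ u v → Dec (Adj u v)) where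

    reach? : ∀ S u v → Dec (Reach G S u v)
    reach? S = go S (<-wellFounded ∣ S ∣)
      where
      go : ∀ S → Acc _<_ ∣ S ∣ → ∀ u v → Dec (Reach G S u v)
      go S (acc rs) u v with u ∈? S
      ... | no u∉S = no (u∉S ∘ reach-start)
      ... | yes u∈S = map′ to from
              ((u ≟ v) ⊎-dec any? (λ w → adj? u w ×-dec go (S - u) (rs (x∈p⇒∣p-x∣<∣p∣ u∈S)) w v))
        where
        to : u ≡ v ⊎ (∃ λ w → Adj u w × Reach G (S - u) w v) → Reach G S u v
        to (inj₁ refl) = here u∈S
        to (inj₂ (w , e , p)) = step u∈S e (reach-mono (p-x⊆p S u) p)
        from : Reach G S u v → u ≡ v ⊎ ∃ λ w → Adj u w × Reach G (S - u) w v
        from p with last-visit u p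
        ... | inj₁ q = contradiction (reach-start q) (x∉p-x S)
        ... | inj₂ q = q

    component : Subset N → Fin N → Subset N
    component S v = comprehension (reach? S v)

    ∈-component⁺ : ∀ {S v w} → Reach G S v w → w ∈ component S v
    ∈-component⁺ {S} {v} = ∈-comprehension⁺ (reach? S v)

    ∈-component⁻ : ∀ {S v w} → w ∈ component S v → Reach G S v w
    ∈-component⁻ {S} {v} = ∈-comprehension⁻ (reach? S v)

    independent? : ∀ r → Decidable (Ind r G)
    independent? r S = map′
      (λ small v v∈S T T⊆ → ≤-trans (p⊆q⇒∣p∣≤∣q∣ (λ w∈T → ∈-component⁺ (T⊆ _ w∈T))) (small v v∈S))
      (λ ind v v∈S → ind v v∈S (component S v) (λ _ → ∈-component⁻))
      (all? (λ v → (v ∈? S) →-dec (∣ component S v ∣ ≤? r)))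

  -- `X` need not lie in `S`; it only has to contain every component of `G[S]` that it meets, so
  -- that its size bounds theirs.
  Closed : Subset N → Subset N → Set
  Closed S X = ∀ {a b} → a ∈ X → Adj a b → a ∈ S → b ∈ S → b ∈ X

  independent-⊆ : ∀ {r S S′} → S ⊆ S′ → Ind r G S′ → Ind r G S
  independent-⊆ S⊆S′ ind v v∈S T T⊆ = ind v (S⊆S′ v∈S) T (λ w w∈T → reach-mono S⊆S′ (T⊆ w w∈T))

  closed⇒component≤ : ∀ {r S X v} → Closed S X → v ∈ X → ∣ X ∣ ≤ r →
                      ∀ T → (∀ w → w ∈ T → Reach G S v w) → ∣ T ∣ ≤ r
  closed⇒component≤ {X = X} cl v∈X X≤r T T⊆ =
    ≤-trans (p⊆q⇒∣p∣≤∣q∣ (λ w∈T → reach-closed (_∈ X) cl v∈X (T⊆ _ w∈T))) X≤r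

  -- A component of the new set that meets `X` stays in `X`; any other avoids `w`, so it is
  -- connected inside `F` and bounded there.
  independent-exchange : (∀ {u v} → Adj u v → Adj v u) → ∀ {r F u w} X → Ind r G F →
                         Closed ((F - u) ∪ ⁅ w ⁆) X → w ∈ X → ∣ X ∣ ≤ r → Ind r G ((F - u) ∪ ⁅ w ⁆)
  independent-exchange adj-sym {r} {F} {u} {w} X ind cl w∈X X≤r v v∈F′ T T⊆ with v ∈? X
  ... | yes v∈X = closed⇒component≤ {X = X} cl v∈X X≤r T T⊆
  ... | no v∉X = ind v (old v∈F′ v∉X) T (λ t t∈T → avoid v∉X (T⊆ t t∈T))
    where
    old : ∀ {a} → a ∈ (F - u) ∪ ⁅ w ⁆ → a ∉ X → a ∈ F
    old a∈ a∉X with ∈-∪⁅⁆⁻ (F - u) a∈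
    ... | inj₁ a∈F-u = p-x⊆p F u a∈F-u
    ... | inj₂ refl = contradiction w∈X a∉X
    avoid : ∀ {a b} → a ∉ X → Reach G ((F - u) ∪ ⁅ w ⁆) a b → Reach G F a b
    avoid a∉X (here a∈) = here (old a∈ a∉X)
    avoid a∉X (step a∈ e p) =
      step (old a∈ a∉X) e (avoid (λ b∈X → a∉X (cl b∈X (adj-sym e) (reach-start p) a∈)) p)

-- Block graphs

-- Away from its root, G is a forest of cliques: block v is the clique joining v to its siblings
-- and to parent v. At the root itself only the edges listed below are required, so that
-- further edges may close a cycle through it.
record RootedBlocks (G : Graph) : Set₁ where
  open Graph G
  field
    root         : Fin N
    Block        : Set
    _≟ᵇ_         : (β γ : Block) → Dec (β ≡ γ)
    block        : Fin N → Block
    parent       : Fin N → Fin N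
    rank         : Fin N → ℕ
    bound        : ℕ
    parent-cong  : ∀ {u v} → block u ≡ block v → parent u ≡ parent v
    sibling-adj  : ∀ {u v} → block u ≡ block v → u ≢ v → Adj u v
    parent-adj   : ∀ u → Adj u (parent u)
    kin          : ∀ {u v} → u ≢ root → v ≢ root → Adj u v →
                   block u ≡ block v ⊎ parent u ≡ v ⊎ parent v ≡ u
    rank-parent  : ∀ {u} → u ≢ root → rank u < rank (parent u)
    rank≤bound   : ∀ u → rank u ≤ bound

-- `Z` absorbs the part of `H` around the root. Being closed in `H` and of size at most `r`, it
-- cannot spoil independence, and on the remaining vertices `V` the blocks form a forest.
module BlockForest {G : Graph} (adj-sym : ∀ {u v} → Graph.Adj G u v → Graph.Adj G v u)
                   (adj? : ∀ u v → Dec (Graph.Adj G u v)) (R : RootedBlocks G) (r : ℕ)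
                   {C H Z : Subset (Graph.N G)} (C⊆H : C ⊆ H) (C-ind : Ind r G C)
                   (Z-closed : Closed {G} H Z) (∣Z∣≤r : ∣ Z ∣ ≤ r)
                   (root∈Z : RootedBlocks.root R ∈ H → RootedBlocks.root R ∈ Z) where

  open Graph G
  open RootedBlocks R

  private
    V : Subset N
    V = H ─ Z

    V⊆H : V ⊆ H
    V⊆H = p─q⊆p H Z

    V-closed : ∀ {a b} → a ∈ V → Adj a b → b ∈ H → b ∈ V
    V-closed a∈V e b∈H = x∈p∧x∉q⇒x∈p─q b∈H
      λ b∈Z → x∈p─q⇒x∉q H Z a∈V (Z-closed b∈Z (adj-sym e) b∈H (V⊆H a∈V))

    ≢root : ∀ {a} → a ∈ V → a ≢ root
    ≢root a∈V refl = x∈p─q⇒x∉q H Z a∈V (root∈Z (V⊆H a∈V))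

    -- Directed graphs along the parent map, so that reachability in them is the ancestor relation;
    -- in `UpC` every ancestor on the way must be linked.
    Up UpC : Graph
    Up = record { N = N ; Adj = λ u w → parent u ≡ w }
    UpC = record { N = N ; Adj = λ u w → parent u ≡ w × w ∈ C }

    Below : Fin N → Fin N → Set
    Below = Reach Up V

    below? : ∀ u v → Dec (Below u v)
    below? = reach? {Up} (λ u w → parent u ≟ w) V

    InFamily : Fin N → Fin N → Set
    InFamily v u = ∃ λ c → block c ≡ block v × Below u c

    inFamily? : ∀ v → Decidable (InFamily v)
    inFamily? v u = any? λ c → (block c ≟ᵇ block v) ×-dec below? u c

    family subtree : Fin N → Subset N
    family v = comprehension (inFamily? v)
    subtree d = comprehension (λ u → below? u d)

    InFamily⇒∈V : ∀ {v u} → InFamily v u → u ∈ V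
    InFamily⇒∈V (_ , _ , p) = reach-start p

    -- By `kin` every edge joins siblings or a vertex and its parent, so a family is left only from
    -- its clique, up to `parent v`.
    InFamily-neighbour : ∀ {v u a} → InFamily v u → Adj u a → a ∈ V → InFamily v a ⊎ parent v ≡ a
    InFamily-neighbour {v} {u} {a} (c , c~v , p) e a∈V
      with p | kin (≢root (reach-start p)) (≢root a∈V) e
    ... | here u∈V | inj₁ u~a = inj₁ (a , trans (sym u~a) c~v , here a∈V)
    ... | here u∈V | inj₂ (inj₁ u↑a) = inj₂ (trans (sym (parent-cong c~v)) u↑a)
    ... | here u∈V | inj₂ (inj₂ a↑u) = inj₁ (u , c~v , step a∈V a↑u (here u∈V))
    ... | step u∈V u↑ q | inj₁ u~a = inj₁ (c , c~v , step a∈V (trans (sym (parent-cong u~a)) u↑) q)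
    ... | step u∈V refl q | inj₂ (inj₁ refl) = inj₁ (c , c~v , q)
    ... | step u∈V u↑ q | inj₂ (inj₂ a↑u) = inj₁ (c , c~v , step a∈V a↑u (step u∈V u↑ q))

    -- A subtree is entered and left only through its top `d`.
    Below-neighbour : ∀ {d u a} → Below u d → u ≢ d → Adj u a → a ∈ V → Below a d
    Below-neighbour p u≢d e a∈V with p | kin (≢root (reach-start p)) (≢root a∈V) e
    ... | here _ | _ = contradiction refl u≢d
    ... | step u∈V u↑ q | inj₁ u~a = step a∈V (trans (sym (parent-cong u~a)) u↑) q
    ... | step u∈V refl q | inj₂ (inj₁ refl) = q
    ... | step u∈V u↑ q | inj₂ (inj₂ a↑u) = step a∈V a↑u (step u∈V u↑ q)

    rank-mono : ∀ {u c} → Below u c → rank u ≤ rank c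
    rank-mono (here _) = ≤-refl
    rank-mono (step u∈V refl p) = ≤-trans (<⇒≤ (rank-parent (≢root u∈V))) (rank-mono p)

    rank-InFamily : ∀ {v u} → InFamily v u → rank u < rank (parent v)
    rank-InFamily (c , c~v , p) = ≤-<-trans (rank-mono p)
      (subst (λ q → rank c < rank q) (parent-cong c~v) (rank-parent (≢root (reach-end p))))

    last-step : ∀ {w d} → Below w d → w ≢ d → ∃ λ e → e ∈ V × parent e ≡ d × Below w e
    last-step (here _) w≢d = contradiction refl w≢d
    last-step {w} {d} (step {w = w′} w∈V refl p) w≢d with w′ ≟ d
    ... | yes refl = w , w∈V , refl , here w∈V
    ... | no w′≢d with last-step p w′≢d
    ...   | e , e∈V , e↑d , q = e , e∈V , e↑d , step w∈V refl q

    -- `m` is fuel: each step up raises `rank`, which never exceeds `bound`.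
    topmost : ∀ m {u} → u ∈ V → bound ≤ m + rank u → ∃ λ c → Below u c × parent c ∉ V
    topmost m {u} u∈V b≤ with parent u ∈? V
    ... | no ∉V = u , here u∈V , ∉V
    topmost zero {u} u∈V b≤ | yes p∈V =
      contradiction (≤-trans (rank≤bound (parent u)) b≤) (<⇒≱ (rank-parent (≢root u∈V)))
    topmost (suc m) {u} u∈V b≤ | yes p∈V
      with topmost m p∈V (≤-trans b≤ (≤-trans (≤-reflexive (sym (+-suc m (rank u))))
                                              (+-monoʳ-≤ m (rank-parent (≢root u∈V)))))
    ... | c , q , ∉V = c , step u∈V refl q , ∉V

    -- The component of a vertex outside `Z` lies in the family of its topmost ancestor `c`, since
    -- the only exit, `parent c`, is not in `V`.
    small⇒independent : (∀ v → v ∈ V → ∣ family v ∣ ≤ r) → Ind r G H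
    small⇒independent small v v∈H with v ∈? Z
    ... | yes v∈Z = closed⇒component≤ {G} {X = Z} Z-closed v∈Z ∣Z∣≤r
    ... | no v∉Z with topmost bound (x∈p∧x∉q⇒x∈p─q v∈H v∉Z) (m≤m+n bound _)
    ...   | c , p , ∉V = closed⇒component≤ {G} {X = family c} closed
                           (∈-comprehension⁺ (inFamily? c) (c , refl , p)) (small c (reach-end p))
      where
      closed : Closed {G} H (family c)
      closed a∈ e a∈H b∈H with ∈-comprehension⁻ (inFamily? c) a∈
      ... | f with InFamily-neighbour f e (V-closed (InFamily⇒∈V f) e b∈H)
      ...   | inj₁ f′ = ∈-comprehension⁺ (inFamily? c) f′
      ...   | inj₂ refl = contradiction (V-closed (InFamily⇒∈V f) e b∈H) ∉V

    -- The hypotheses describe a deepest large clique: its family is too big for a face, while any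
    -- clique hanging from a family member has a small one.
    module Big {v : Fin N} (v∈V : v ∈ V) (big : r < ∣ family v ∣)
               (small : ∀ e → e ∈ V → InFamily v (parent e) → ∣ family e ∣ ≤ r) where

      -- A family is connected through its clique, so a face containing it would have a component
      -- with more than `r` vertices.
      family⊈face : ∀ {F} → Ind r G F → ¬ family v ⊆ F
      family⊈face {F} ind f⊆F = <⇒≱ big (ind v v∈F (family v) λ u u∈ →
        let _ , c~v , p = ∈-comprehension⁻ (inFamily? v) u∈ in climb c~v p)
        where
        v∈F : v ∈ F
        v∈F = f⊆F (∈-comprehension⁺ (inFamily? v) (v , refl , here v∈V))
        member : ∀ {u} → InFamily v u → u ∈ F
        member = f⊆F ∘ ∈-comprehension⁺ (inFamily? v)
        climb : ∀ {u c} → block c ≡ block v → Below u c → Reach G F v u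
        climb {u} c~v (here u∈V) with v ≟ u
        ... | yes refl = here v∈F
        ... | no v≢u = step v∈F (sibling-adj (sym c~v) v≢u) (here (member (_ , c~v , here u∈V)))
        climb {u} c~v p@(step u∈V refl q) =
          reach-snoc (climb c~v q) (adj-sym (parent-adj u)) (member (_ , c~v , p))

      -- All strict ancestors of d within the family of v lie in C.
      Exposed : Fin N → Set
      Exposed d = ∃ λ c → block c ≡ block v × Reach UpC V d c

      exposed? : Decidable Exposed
      exposed? d = any? λ c → (block c ≟ᵇ block v) ×-dec
        reach? {UpC} (λ u w → (parent u ≟ w) ×-dec (w ∈? C)) V d c

      Hub : Fin N → Set
      Hub d = d ∉ C × Exposed d

      forget : ∀ {u c} → Reach UpC V u c → Below u c
      forget (here u∈V) = here u∈V
      forget (step u∈V (u↑ , _) p) = step u∈V u↑ (forget p)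

      Hub⇒InFamily : ∀ {d} → Hub d → InFamily v d
      Hub⇒InFamily (_ , c , c~v , p) = c , c~v , forget p

      -- The highest vertex outside `C` on the path from `w` up to the clique is a hub.
      Hub-cover : ∀ {w} → InFamily v w → w ∉ C → ∃ λ d → Hub d × Below w d
      Hub-cover (c , c~v , p) w∉C = [ (λ h → h) , (λ (w∈C , _) → contradiction w∈C w∉C) ]′ (go p)
        where
        decide : ∀ {w} → w ∈ V → Exposed w → (∃ λ d → Hub d × Below w d) ⊎ (w ∈ C × Exposed w)
        decide {w} w∈V ex with w ∈? C
        ... | yes w∈C = inj₂ (w∈C , ex)
        ... | no w∉C = inj₁ (w , (w∉C , ex) , here w∈V)
        go : ∀ {w} → Below w c → (∃ λ d → Hub d × Below w d) ⊎ (w ∈ C × Exposed w)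
        go (here w∈V) = decide w∈V (_ , c~v , here w∈V)
        go (step w∈V refl q) with go q
        ... | inj₁ (d , h , b) = inj₁ (d , h , step w∈V refl b)
        ... | inj₂ (p∈C , c′ , c′~v , ex) = decide w∈V (c′ , c′~v , step w∈V (refl , p∈C) ex)

      -- A hub strictly above another would be one of its ancestors in the family, hence linked,
      -- whereas hubs are free.
      Hub-antichain : ∀ {d d′} → Hub d → Hub d′ → Below d′ d → d′ ≡ d
      Hub-antichain {d} h@(d∉C , _) (_ , c , c~v , ex) b =
        [ (λ e → e) , (λ d∈C → contradiction d∈C d∉C) ]′ (go ex b)
        where
        go : ∀ {p} → Reach UpC V p c → Below p d → p ≡ d ⊎ d ∈ C
        go _ (here _) = inj₁ refl
        -- Here `p` is in the clique of `v`, so `d` would be at or above `parent v`, whose rank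
        -- exceeds that of every family member.
        go (here p∈V) (step _ refl b) = contradiction (rank-mono b)
          (<⇒≱ (subst (λ q → rank d < rank q) (sym (parent-cong c~v)) (rank-InFamily (Hub⇒InFamily h))))
        go (step _ (refl , p∈C) ex) (step _ refl b) with go ex b
        ... | inj₁ refl = inj₂ p∈C
        ... | inj₂ d∈C = inj₂ d∈C

      exposed-path : ∀ {F d c} → C ⊆ F → d ∈ F → Reach UpC V d c → Reach G F d c
      exposed-path C⊆F d∈F (here _) = here d∈F
      exposed-path C⊆F d∈F (step _ (refl , p∈C) q) =
        step d∈F (parent-adj _) (exposed-path C⊆F (C⊆F p∈C) q)

      -- The vertices of C above the hubs tie any two of them, together with all
      -- neighbours not below them, into one component.
      Hub-connected : ∀ {F d d′ a} → C ⊆ F → Hub d → Hub d′ → d ∈ F → a ∈ F → a ∈ V →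
                      a ≡ d′ ⊎ (Adj d′ a × ¬ Below a d′) → Reach G F d a
      Hub-connected {F} {d} {d′} {a} C⊆F (_ , c , c~v , ex) (_ , c′ , c′~v , ex′) d∈F a∈F a∈V near
        = go ex′ (kinship near)
        where
        d⇝c : Reach G F d c
        d⇝c = exposed-path C⊆F d∈F ex
        link-sibling : ∀ {b} → b ∈ F → block b ≡ block v → Reach G F d b
        link-sibling {b} b∈F b~v with c ≟ b
        ... | yes refl = d⇝c
        ... | no c≢b = reach-snoc d⇝c (sibling-adj (trans c~v (sym b~v)) c≢b) b∈F
        kinship : a ≡ d′ ⊎ (Adj d′ a × ¬ Below a d′) → block d′ ≡ block a ⊎ parent d′ ≡ a
        kinship (inj₁ refl) = inj₁ refl
        kinship (inj₂ (e , a≰d′)) with kin (≢root (reach-start ex′)) (≢root a∈V) e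
        ... | inj₁ d′~a = inj₁ d′~a
        ... | inj₂ (inj₁ d′↑a) = inj₂ d′↑a
        ... | inj₂ (inj₂ a↑d′) = contradiction (step a∈V a↑d′ (here (reach-start ex′))) a≰d′
        go : Reach UpC V d′ c′ → block d′ ≡ block a ⊎ parent d′ ≡ a → Reach G F d a
        go (here _) (inj₁ d′~a) = link-sibling a∈F (trans (sym d′~a) c′~v)
        go (here _) (inj₂ d′↑a) =
          reach-snoc d⇝c (subst (Adj c) (trans (parent-cong (trans c~v (sym c′~v))) d′↑a) (parent-adj c)) a∈F
        go (step _ (refl , p∈C) q) k = close k
          where
          up : Reach G F (parent d′) c′
          up = exposed-path C⊆F (C⊆F p∈C) q
          d⇝parent : Reach G F d (parent d′)
          d⇝parent = reach-trans (link-sibling (reach-end up) c′~v) (reach-sym adj-sym up)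
          close : block d′ ≡ block a ⊎ parent d′ ≡ a → Reach G F d a
          close (inj₁ d′~a) = reach-snoc d⇝parent
            (subst (λ q → Adj q a) (sym (parent-cong d′~a)) (adj-sym (parent-adj a))) a∈F
          close (inj₂ refl) = d⇝parent

      -- With `d` missing, the component of `w` is confined to the family of the child `e` of `d`
      -- above `w`, which is small by the choice of `v`.
      branch : ∀ {F d w} → F ⊆ H → InFamily v d → d ∉ F → Below w d → w ≢ d →
               ∃ λ X → Closed {G} F X × w ∈ X × ∣ X ∣ ≤ r
      branch {F} {d} {w} F⊆H fd d∉F w<d w≢d with last-step w<d w≢d
      ... | e , e∈V , refl , w≤e =
        family e , closed , ∈-comprehension⁺ (inFamily? e) (e , refl , w≤e) , small e e∈V fd
        where
        closed : Closed {G} F (family e)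
        closed a∈ adj a∈F b∈F with ∈-comprehension⁻ (inFamily? e) a∈
        ... | f with InFamily-neighbour f adj (V-closed (InFamily⇒∈V f) adj (F⊆H b∈F))
        ...   | inj₁ f′ = ∈-comprehension⁺ (inFamily? e) f′
        ...   | inj₂ refl = contradiction b∈F d∉F

      -- The family does not fit into a face, so some vertex of it is missing; `C ⊆ F` makes that
      -- vertex free, hence below a hub.
      outside-hub : ∀ {F} → C ⊆ F → Ind r G F → ∃ λ w → InFamily v w × w ∉ F × ∃ λ d → Hub d × Below w d
      outside-hub {F} C⊆F ind with ⊈⇒∃ (family v) F (family⊈face ind)
      ... | w , w∈ , w∉F = let f = ∈-comprehension⁻ (inFamily? v) w∈ in w , f , w∉F , Hub-cover f (w∉F ∘ C⊆F)

      maxHub : ∃ λ d → Hub d × ∀ d′ → Hub d′ → ∣ subtree d′ ∣ ≤ ∣ subtree d ∣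
      -- `C` is itself a face, so a hub exists; minimising `N ∸ ∣ subtree d ∣` then selects a
      -- largest subtree.
      maxHub with outside-hub (λ w∈ → w∈) C-ind
      ... | _ , _ , _ , hub with argmin (λ d → ¬? (d ∈? C) ×-dec exposed? d) (λ d → N ∸ ∣ subtree d ∣)
                                        (proj₁ hub , proj₁ (proj₂ hub))
      ...   | d , h , min = d , h , λ d′ h′ → ∸-cancelʳ-≤ (∣p∣≤n (subtree d′)) (min d′ h′)

      maxHub-sheds : ∀ {d} → Hub d → (∀ d′ → Hub d′ → ∣ subtree d′ ∣ ≤ ∣ subtree d ∣) →
                     Sheds (Ind r G) C H d
      maxHub-sheds {d} h max F ind C⊆F F⊆H d∈F with subtree d ⊆? F
      ... | no T⊈F with ⊈⇒∃ (subtree d) F T⊈F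
      ...   | w , w∈T , w∉F = w , w∈H , w∉F ,
                independent-exchange adj-sym X ind X-closed w∈X ∣X∣≤r
        where
        w≢d : w ≢ d
        w≢d refl = w∉F d∈F
        w<d = ∈-comprehension⁻ (λ u → below? u d) w∈T
        w∈H = V⊆H (reach-start w<d)
        d∉F′ : d ∉ (F - d) ∪ ⁅ w ⁆
        d∉F′ d∈ = [ x∉p-x F , w≢d ∘ sym ]′ (∈-∪⁅⁆⁻ (F - d) d∈)
        X-data = branch (∪⁅⁆-⊆ (F⊆H ∘ p-x⊆p F d) w∈H) (Hub⇒InFamily h) d∉F′ w<d w≢d
        X = proj₁ X-data
        X-closed = proj₁ (proj₂ X-data)
        w∈X = proj₁ (proj₂ (proj₂ X-data))
        ∣X∣≤r = proj₂ (proj₂ (proj₂ X-data))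
      -- The subtree of `d` lies in `F`, so the missing `w` sits below another hub `d′`. Its new
      -- component fits into `(K ─ T) ∪ T′`, or into a branch below `d′` when `d′` is absent.
      maxHub-sheds {d} h max F ind C⊆F F⊆H d∈F | yes T⊆F with outside-hub C⊆F ind
      ... | w , fw , w∉F , d′ , h′ , w≤d′ =
        w , w∈H , w∉F , independent-exchange adj-sym (proj₁ X) ind (proj₁ (proj₂ X))
                          (proj₁ (proj₂ (proj₂ X))) (proj₂ (proj₂ (proj₂ X)))
        where
        F′ = (F - d) ∪ ⁅ w ⁆
        w∈H = V⊆H (InFamily⇒∈V fw)
        F′⊆H : F′ ⊆ H
        F′⊆H = ∪⁅⁆-⊆ (F⊆H ∘ p-x⊆p F d) w∈H
        F′∌d : d ∉ F′
        F′∌d d∈ with ∈-∪⁅⁆⁻ (F - d) d∈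
        ... | inj₁ d∈F-d = x∉p-x F d∈F-d
        ... | inj₂ refl = w∉F d∈F
        K T T′ : Subset N
        K = component adj? F d
        T = subtree d
        T′ = subtree d′
        T⁻ : ∀ {u} → u ∈ T → Below u d
        T⁻ = ∈-comprehension⁻ (λ u → below? u d)
        T′⁻ : ∀ {u} → u ∈ T′ → Below u d′
        T′⁻ = ∈-comprehension⁻ (λ u → below? u d′)
        T′⁺ : ∀ {u} → Below u d′ → u ∈ T′
        T′⁺ = ∈-comprehension⁺ (λ u → below? u d′)
        d′∉T : ¬ Below d′ d
        d′∉T d′<d with Hub-antichain h h′ d′<d
        ... | refl = w∉F (T⊆F (∈-comprehension⁺ (λ u → below? u d) w≤d′))
        T⊆K : T ⊆ K
        T⊆K u∈T = ∈-component⁺ adj? (descend (T⁻ u∈T))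
          where
          descend : ∀ {u} → Below u d → Reach G F d u
          descend (here _) = here d∈F
          descend p@(step u∈V refl q) =
            reach-snoc (descend q) (adj-sym (parent-adj _)) (T⊆F (∈-comprehension⁺ (λ u → below? u d) p))
        ∣K─T∪T′∣≤r : ∣ (K ─ T) ∪ T′ ∣ ≤ r
        ∣K─T∪T′∣≤r = begin
          ∣ (K ─ T) ∪ T′ ∣       ≤⟨ ∣p∪q∣≤∣p∣+∣q∣ (K ─ T) T′ ⟩
          ∣ K ─ T ∣ + ∣ T′ ∣     ≤⟨ +-monoʳ-≤ ∣ K ─ T ∣ (max d′ h′) ⟩
          ∣ K ─ T ∣ + ∣ T ∣      ≡⟨ q⊆p⇒∣p─q∣+∣q∣≡∣p∣ K T T⊆K ⟩
          ∣ K ∣                  ≤⟨ ind d d∈F K (λ _ → ∈-component⁻ adj?) ⟩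
          r                      ∎
          where open ≤-Reasoning
        adj-T : ∀ {a b} → a ∈ V → a ≢ d → ¬ Below a d → Adj a b → b ∈ F′ → ¬ Below b d
        -- The only entrance to the subtree of `d` is `d`, which is not in `F′`.
        adj-T a∈V a≢d a≰d e b∈F′ b<d =
          a≰d (Below-neighbour b<d (λ { refl → F′∌d b∈F′ }) (adj-sym e) a∈V)
        outer : ∀ {b} → b ∈ F′ → Reach G F d b ⊎ b ∈ T′ → ¬ Below b d → b ∈ (K ─ T) ∪ T′
        outer b∈F′ (inj₁ p) b≰d = x∈p∪q⁺ (inj₁ (x∈p∧x∉q⇒x∈p─q (∈-component⁺ adj? p) (b≰d ∘ T⁻)))
        outer b∈F′ (inj₂ b∈T′) b≰d = x∈p∪q⁺ (inj₂ b∈T′)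
        old : ∀ {b} → b ∈ F′ → b ∈ F ⊎ b ≡ w
        old b∈ = map₁ (p-x⊆p F d) (∈-∪⁅⁆⁻ (F - d) b∈)
        closed : d′ ∈ F′ → Closed {G} F′ ((K ─ T) ∪ T′)
        closed d′∈F′ {a} {b} a∈X e a∈F′ b∈F′ with x∈p∪q⁻ (K ─ T) T′ a∈X
        closed d′∈F′ {a} {b} a∈X e a∈F′ b∈F′ | inj₂ a∈T′ with b ∈? T′
        ... | yes b∈T′ = x∈p∪q⁺ (inj₂ b∈T′)
        ... | no b∉T′ with a ≟ d′
        ...   | no a≢d′ = contradiction
                (T′⁺ (Below-neighbour (T′⁻ a∈T′) a≢d′ e (V-closed (reach-start (T′⁻ a∈T′)) e (F′⊆H b∈F′)))) b∉T′
        ...   | yes refl with old b∈F′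
        ...     | inj₂ refl = contradiction (T′⁺ w≤d′) b∉T′
        -- The edge leaves the subtree from `d′` itself. Linked vertices tie the two hubs together,
        -- so `b` was already in the component `K` of `d`.
        ...     | inj₁ b∈F = outer b∈F′
                  (inj₁ (Hub-connected C⊆F h h′ d∈F b∈F (V-closed a∈V e (F⊆H b∈F)) (inj₂ (e , b∉T′ ∘ T′⁺))))
                  (adj-T a∈V (λ { refl → d′∉T (here a∈V) }) d′∉T e b∈F′)
          where a∈V = InFamily⇒∈V (Hub⇒InFamily h′)
        closed d′∈F′ {a} {b} a∈X e a∈F′ b∈F′ | inj₁ a∈K─T with old b∈F′
        ... | inj₂ refl = x∈p∪q⁺ (inj₂ (T′⁺ w≤d′))
        ... | inj₁ b∈F = outer b∈F′ (inj₁ d⇝b) (adj-T a∈V (λ { refl → F′∌d a∈F′ }) a≰d e b∈F′)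
          where
          d⇝a : Reach G F d a
          d⇝a = ∈-component⁻ adj? (p─q⊆p K T a∈K─T)
          d⇝b = reach-snoc d⇝a e b∈F
          a≰d : ¬ Below a d
          a≰d a<d = x∈p─q⇒x∉q K T a∈K─T (∈-comprehension⁺ (λ u → below? u d) a<d)
          a∈V : a ∈ V
          a∈V = reach-closed (_∈ V) (λ a∈V e _ b∈F → V-closed a∈V e (F⊆H b∈F))
                  (InFamily⇒∈V (Hub⇒InFamily h)) d⇝a
        X : ∃ λ X → Closed {G} F′ X × w ∈ X × ∣ X ∣ ≤ r
        X with d′ ∈? F′
        ... | yes d′∈F′ = (K ─ T) ∪ T′ , closed d′∈F′ , x∈p∪q⁺ (inj₂ (T′⁺ w≤d′)) , ∣K─T∪T′∣≤r
        ... | no d′∉F′ = branch F′⊆H (Hub⇒InFamily h′) d′∉F′ w≤d′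
                (λ { refl → d′∉F′ (y∈p∪⁅y⁆ (F - d) w) })

  next : Ind r G H ⊎ ∃ λ u → u ∈ H × u ∉ C × Sheds (Ind r G) C H u
  next with any? (λ v → (v ∈? V) ×-dec (r <? ∣ family v ∣))
  ... | no ∄ = inj₁ (small⇒independent λ v v∈V → ≮⇒≥ λ big → ∄ (v , v∈V , big))
  -- Minimal rank of the parent means greatest depth: a clique hanging from a family member has a
  -- parent of smaller rank, hence a small family.
  ... | yes some with argmin (λ v → (v ∈? V) ×-dec (r <? ∣ family v ∣)) (λ v → rank (parent v)) some
  ...   | v , (v∈V , big) , min =
    let d , h , max = maxHub
    in inj₂ (d , V⊆H (InFamily⇒∈V (Hub⇒InFamily h)) , proj₁ h , maxHub-sheds h max)
    where
    small : ∀ e → e ∈ V → InFamily v (parent e) → ∣ family e ∣ ≤ r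
    small e e∈V f = ≮⇒≥ λ big′ → <⇒≱ (rank-InFamily f) (min e (e∈V , big′))
    open Big v∈V big small

-- Clique cycles with attached stars

module CliqueCycle {r : ℕ} (D : GrData r) where
  open GrData D
  open Graph graph using (Adj)

  adj? : ∀ u v → Dec (Adj u v)
  adj? u v = ¬? (u ≟ v) ×-dec
    (any? (λ i → (u ∈? B i) ×-dec (v ∈? B i)) ⊎-dec
     map′ (λ (i , a , m) → (i , a) , m) (λ ((i , a) , m) → i , a , m)
       (any? λ i → any? λ a → (u ∈? SC (i , a)) ×-dec (v ∈? SC (i , a))))

  adj-sym : ∀ {u v} → Adj u v → Adj v u
  adj-sym (u≢v , inj₁ (i , u∈ , v∈)) = u≢v ∘ sym , inj₁ (i , v∈ , u∈)
  adj-sym (u≢v , inj₂ (p , u∈ , v∈)) = u≢v ∘ sym , inj₂ (p , v∈ , u∈)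

  Star : Set
  Star = Σ (Fin n) (λ i → Fin (k i))

  Block : Set
  Block = Fin n ⊎ Star

  _≟ˢ_ : (p q : Star) → Dec (p ≡ q)
  _≟ˢ_ = Product.≡-dec _≟_ _≟_

  clique : Block → Subset N
  clique = [ B , SC ]′

  -- `B i` hangs from `x i`, the vertex it shares with the next clique, so climbing from parent to
  -- parent runs around the cycle in the direction of `Consec`.
  centre : Block → Fin N
  centre = [ x , x ∘ proj₁ ]′

  clique-adj : ∀ {u v} β → u ∈ clique β → v ∈ clique β → u ≢ v → Adj u v
  clique-adj (inj₁ i) u∈ v∈ u≢v = u≢v , inj₁ (i , u∈ , v∈)
  clique-adj (inj₂ p) u∈ v∈ u≢v = u≢v , inj₂ (p , u∈ , v∈)

  adj⇒clique : ∀ {u v} → Adj u v → ∃ λ β → u ∈ clique β × v ∈ clique β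
  adj⇒clique (_ , inj₁ (i , m)) = inj₁ i , m
  adj⇒clique (_ , inj₂ (p , m)) = inj₂ p , m

  successor : (i : Fin n) → ∃ (Consec i)
  successor i with m≤n⇒m<n∨m≡n (toℕ<n i)
  ... | inj₁ 1+i<n = fromℕ< 1+i<n , inj₁ (sym (toℕ-fromℕ< 1+i<n))
  ... | inj₂ 1+i≡n = fromℕ< 0<n , inj₂ (1+i≡n , toℕ-fromℕ< 0<n)
    where 0<n = ≤-trans (s≤s z≤n) n≥3

  consec? : (i j : Fin n) → Dec (Consec i j)
  consec? i j = (suc (toℕ i) ≟ⁿ toℕ j) ⊎-dec ((suc (toℕ i) ≟ⁿ n) ×-dec (toℕ j ≟ⁿ 0))

  consec-irrefl : ∀ {i} → ¬ Consec i i
  consec-irrefl (inj₁ eq) = 1+n≢n eq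
  consec-irrefl {i} (inj₂ (1+i≡n , i≡0)) =
    contradiction (subst (3 ≤_) (trans (sym 1+i≡n) (cong suc i≡0)) n≥3) λ { (s≤s ()) }

  x∈B∩B : ∀ {i j} → Consec i j → x i ∈ B i × x i ∈ B j
  x∈B∩B {i} {j} c = x∈p∩q⁻ (B i) (B j) (subst (x i ∈_) (sym (consec-meet i j c)) (x∈⁅x⁆ (x i)))

  consec-common : ∀ {i j v} → Consec i j → v ∈ B i → v ∈ B j → v ≡ x i
  consec-common {i} {j} c v∈i v∈j = x∈⁅y⁆⇒x≡y (x i) (subst (_ ∈_) (consec-meet i j c) (x∈p∩q⁺ (v∈i , v∈j)))

  centre∈clique : ∀ β → centre β ∈ clique β
  centre∈clique (inj₁ i) = proj₁ (x∈B∩B (proj₂ (successor i)))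
  centre∈clique (inj₂ p) = SC-center p

  Lies : Fin N → Block → Set
  Lies v β = v ∈ clique β × v ≢ centre β

  SC∩B : ∀ {p i v} → v ∈ SC p → v ∈ B i → v ≡ x (proj₁ p)
  SC∩B {p} {i} v∈SC v∈B = x∈⁅y⁆⇒x≡y _ (SC-new p (x∈p∩q⁺ (v∈SC , ∈-⋃-tabulate⁺ B i v∈B)))

  SC∩SC : ∀ {p q v} → p ≢ q → v ∈ SC p → v ∈ SC q → v ≡ x (proj₁ p)
  SC∩SC {p} {q} p≢q v∈p v∈q = x∈⁅y⁆⇒x≡y _ (SC-disjoint p q p≢q (x∈p∩q⁺ (v∈p , v∈q)))

  -- Distinct cliques meet at most in the centre of one of them.
  lies-unique : ∀ {v} β γ → Lies v β → Lies v γ → β ≡ γ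
  lies-unique (inj₁ i) (inj₁ j) (v∈i , v≢i) (v∈j , v≢j) with i ≟ j | consec? i j | consec? j i
  ... | yes refl | _ | _ = refl
  ... | no _ | yes c | _ = contradiction (consec-common c v∈i v∈j) v≢i
  ... | no _ | no _ | yes c = contradiction (consec-common c v∈j v∈i) v≢j
  ... | no i≢j | no ¬c | no ¬c′ =
    contradiction (subst (_ ∈_) (nonconsec-disjoint i j i≢j ¬c ¬c′) (x∈p∩q⁺ (v∈i , v∈j))) ∉⊥
  lies-unique (inj₁ i) (inj₂ p) (v∈i , _) (v∈p , v≢p) = contradiction (SC∩B v∈p v∈i) v≢p
  lies-unique (inj₂ p) (inj₁ i) (v∈p , v≢p) (v∈i , _) = contradiction (SC∩B v∈p v∈i) v≢p
  lies-unique (inj₂ p) (inj₂ q) (v∈p , v≢p) (v∈q , _) with p ≟ˢ q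
  ... | yes refl = refl
  ... | no p≢q = contradiction (SC∩SC p≢q v∈p v∈q) v≢p

  lies-successor : ∀ i → Lies (x i) (inj₁ (proj₁ (successor i)))
  lies-successor i with successor i
  ... | j , c = proj₂ (x∈B∩B c) , λ xi≡xj →
    consec-irrefl (subst (Consec i) (sym (x-injective i j xi≡xj)) c)

  lies : ∀ v → ∃ (Lies v)
  lies v with any? (λ i → x i ≟ v)
  -- Connecting vertices come first: `x i` is the centre of `B i` and of its stars, so only the
  -- successor clique holds it as a non-centre.
  ... | yes (i , refl) = inj₁ _ , lies-successor i
  ... | no ∄ with covers v
  ...   | inj₁ (i , v∈) = inj₁ i , v∈ , λ eq → ∄ (i , sym eq)
  ...   | inj₂ (p , v∈) = inj₂ p , v∈ , λ eq → ∄ (proj₁ p , sym eq)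

  block : Fin N → Block
  block v = proj₁ (lies v)

  parent : Fin N → Fin N
  parent v = centre (block v)

  lies⇒block≡ : ∀ {v} β → Lies v β → block v ≡ β
  lies⇒block≡ {v} β l = lies-unique _ β (proj₂ (lies v)) l

  o : Fin n
  o = proj₁ big-star

  -- The distance from o along the cycle, with n instead of 0 at o itself.
  position : Fin n → ℕ
  position i with toℕ o <? toℕ i
  ... | yes _ = toℕ i ∸ toℕ o
  ... | no _ = toℕ i + n ∸ toℕ o

  position>0 : ∀ i → 0 < position i
  position>0 i with toℕ o <? toℕ i
  ... | yes o<i = m<n⇒0<n∸m o<i
  ... | no _ = m<n⇒0<n∸m (≤-trans (toℕ<n o) (m≤n+m n (toℕ i)))

  position≤ : ∀ i → position i ≤ n + n
  position≤ i with toℕ o <? toℕ i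
  ... | yes _ = ≤-trans (m∸n≤m (toℕ i) (toℕ o)) (≤-trans (<⇒≤ (toℕ<n i)) (m≤m+n n n))
  ... | no _ = ≤-trans (m∸n≤m (toℕ i + n) (toℕ o)) (+-monoˡ-≤ n (<⇒≤ (toℕ<n i)))

  position-consec : ∀ {i j} → i ≢ o → Consec i j → position i < position j
  position-consec {i} {j} i≢o c with toℕ o <? toℕ i | toℕ o <? toℕ j | c
  ... | yes o<i | yes _ | inj₁ eq = ∸-monoˡ-< (≤-reflexive eq) (<⇒≤ o<i)
  ... | yes o<i | no o≮j | inj₁ eq = contradiction (<-trans o<i (≤-reflexive eq)) o≮j
  ... | no o≮i | yes o<j | inj₁ eq =
    contradiction (toℕ-injective (≤-antisym (≮⇒≥ o≮i) (s≤s⁻¹ (≤-trans o<j (≤-reflexive (sym eq)))))) i≢o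
  ... | no o≮i | no _ | inj₁ eq =
    ∸-monoˡ-< (≤-reflexive (cong (_+ n) eq)) (≤-trans (<⇒≤ (toℕ<n o)) (m≤n+m n (toℕ i)))
  ... | _ | yes o<j | inj₂ (_ , j≡0) = contradiction (subst (toℕ o <_) j≡0 o<j) λ ()
  ... | yes o<i | no _ | inj₂ (1+i≡n , j≡0) =
    ∸-monoˡ-< (≤-trans (≤-reflexive 1+i≡n) (m≤n+m n (toℕ j))) (<⇒≤ o<i)
  ... | no o≮i | no _ | inj₂ (1+i≡n , _) =
    contradiction (toℕ-injective (≤-antisym (≮⇒≥ o≮i) (s≤s⁻¹ (≤-trans (toℕ<n o) (≤-reflexive (sym 1+i≡n)))))) i≢o

  -- Only connecting vertices are parents, and positions start at 1, so rank 0 is safe for all other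
  -- vertices.
  rank : Fin N → ℕ
  rank v with any? (λ i → x i ≟ v)
  ... | yes (i , _) = position i
  ... | no _ = 0

  rank-x : ∀ i → rank (x i) ≡ position i
  rank-x i with any? (λ j → x j ≟ x i)
  ... | yes (j , eq) = cong position (x-injective j i eq)
  ... | no ∄ = contradiction (i , refl) ∄

  rank-other : ∀ {v} → ¬ (∃ λ i → x i ≡ v) → rank v ≡ 0
  rank-other {v} ∄ with any? (λ i → x i ≟ v)
  ... | yes e = contradiction e ∄
  ... | no _ = refl

  rank≤ : ∀ v → rank v ≤ n + n
  rank≤ v with any? (λ i → x i ≟ v)
  ... | yes (i , _) = position≤ i
  ... | no _ = z≤n

  rank-centre>0 : ∀ β → 0 < rank (centre β)
  rank-centre>0 (inj₁ i) = subst (0 <_) (sym (rank-x i)) (position>0 i)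
  rank-centre>0 (inj₂ p) = subst (0 <_) (sym (rank-x (proj₁ p))) (position>0 (proj₁ p))

  rank-parent : ∀ {u} → u ≢ x o → rank u < rank (parent u)
  rank-parent {u} u≢root = go (any? (λ i → x i ≟ u))
    where
    go : Dec (∃ λ i → x i ≡ u) → rank u < rank (parent u)
    go (no ∄) = subst (_< rank (parent u)) (sym (rank-other ∄)) (rank-centre>0 (block u))
    go (yes (i , refl)) = begin-strict
      rank (x i)                       ≡⟨ rank-x i ⟩
      position i                       <⟨ position-consec (λ { refl → u≢root refl }) (proj₂ (successor i)) ⟩
      position (proj₁ (successor i))   ≡⟨ rank-x _ ⟨
      rank (x (proj₁ (successor i)))   ≡⟨ cong (rank ∘ centre) (lies⇒block≡ (inj₁ _) (lies-successor i)) ⟨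
      rank (parent (x i))              ∎
      where open ≤-Reasoning

  -- Both ends of an edge lie in a common clique `β`, and an end other than its centre has `β` as
  -- its block.
  kin : ∀ {u v} → Adj u v → block u ≡ block v ⊎ parent u ≡ v ⊎ parent v ≡ u
  kin {u} {v} e with adj⇒clique e
  ... | β , u∈ , v∈ with u ≟ centre β | v ≟ centre β
  ...   | no u≢ | no v≢ = inj₁ (trans (lies⇒block≡ β (u∈ , u≢)) (sym (lies⇒block≡ β (v∈ , v≢))))
  ...   | no u≢ | yes refl = inj₂ (inj₁ (cong centre (lies⇒block≡ β (u∈ , u≢))))
  ...   | yes refl | no v≢ = inj₂ (inj₂ (cong centre (lies⇒block≡ β (v∈ , v≢))))
  ...   | yes refl | yes refl = contradiction refl (proj₁ e)

  rootedBlocks : RootedBlocks graph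
  rootedBlocks = record
    { root = x o
    ; Block = Block
    ; _≟ᵇ_ = Sum.≡-dec _≟_ _≟ˢ_
    ; block = block
    ; parent = parent
    ; rank = rank
    ; bound = n + n
    ; parent-cong = cong centre
    ; sibling-adj = λ {u} {v} eq → clique-adj (block u) (proj₁ (proj₂ (lies u)))
        (subst (λ β → v ∈ clique β) (sym eq) (proj₁ (proj₂ (lies v))))
    ; parent-adj = λ u → clique-adj (block u) (proj₁ (proj₂ (lies u))) (centre∈clique (block u))
        (proj₂ (proj₂ (lies u)))
    ; kin = λ _ _ → kin
    ; rank-parent = rank-parent
    ; rank≤bound = rank≤
    }

  -- The star with more than r vertices

  S : Subset N
  S = starVertices o

  xo∈S : x o ∈ S
  xo∈S = x∈p∪q⁺ (inj₁ (x∈⁅x⁆ (x o)))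

  S-clique : ∀ {v} → v ∈ S → v ≢ x o → ∃ λ a → v ∈ SC (o , a)
  S-clique v∈S v≢ with x∈p∪q⁻ ⁅ x o ⁆ _ v∈S
  ... | inj₁ v∈ = contradiction (x∈⁅y⁆⇒x≡y (x o) v∈) v≢
  ... | inj₂ v∈ = ∈-⋃-tabulate⁻ (λ a → SC (o , a)) v∈

  S-adj : ∀ {v} → v ∈ S → v ≢ x o → Adj (x o) v
  S-adj v∈S v≢ with S-clique v∈S v≢
  ... | a , v∈ = v≢ ∘ sym , inj₂ ((o , a) , SC-center (o , a) , v∈)

  -- A star vertex other than the centre lies in no clique outside its star, so `S` is left only
  -- through `x o`.
  S-neighbour : ∀ {u v} → u ∈ S → u ≢ x o → Adj u v → v ∈ S
  S-neighbour u∈S u≢ e with S-clique u∈S u≢ | adj⇒clique e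
  ... | a , u∈ | inj₁ i , u∈B , _ = contradiction (SC∩B u∈ u∈B) u≢
  ... | a , u∈ | inj₂ p , u∈p , v∈p with (o , a) ≟ˢ p
  ...   | yes refl = x∈p∪q⁺ (inj₂ (∈-⋃-tabulate⁺ (λ a → SC (o , a)) a v∈p))
  ...   | no q≢p = contradiction (SC∩SC q≢p u∈ u∈p) u≢

  S-reach : ∀ {F v} → x o ∈ F → v ∈ F → v ∈ S → Reach graph F (x o) v
  S-reach {v = v} xo∈F v∈F v∈S with v ≟ x o
  ... | yes refl = here v∈F
  ... | no v≢ = step xo∈F (S-adj v∈S v≢) (here v∈F)

  S⊈face : ∀ {F} → Ind r graph F → ¬ S ⊆ F
  S⊈face ind S⊆F = <⇒≱ (proj₂ (proj₂ big-star))
    (ind (x o) (S⊆F xo∈S) S λ v v∈S → S-reach (S⊆F xo∈S) (S⊆F v∈S) v∈S)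

  -- Without `x o` the rest of the star is cut off. Together with `w` it has at most as many
  -- vertices as `F ∩ S`, which `x o` held in one component.
  exchange-centre : ∀ {F w} → Ind r graph F → x o ∈ F → w ∈ S → w ∉ F → Ind r graph ((F - x o) ∪ ⁅ w ⁆)
  exchange-centre {F} {w} ind xo∈F w∈S w∉F =
    independent-exchange adj-sym X ind closed (y∈p∪⁅y⁆ _ w)
      (≤-trans (∣p-x∪⁅y⁆∣≤∣p∣ (F ∩ S) w (x∈p∩q⁺ (xo∈F , xo∈S)))
               (ind (x o) xo∈F (F ∩ S) λ v v∈ →
                 let v∈F , v∈S = x∈p∩q⁻ F S v∈ in S-reach xo∈F v∈F v∈S))
    where
    X = ((F ∩ S) - x o) ∪ ⁅ w ⁆
    X⁻ : ∀ {a} → a ∈ X → a ∈ S × a ≢ x o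
    X⁻ a∈ with ∈-∪⁅⁆⁻ ((F ∩ S) - x o) a∈
    ... | inj₁ a∈′ = p∩q⊆q F S (p-x⊆p (F ∩ S) (x o) a∈′) , x∈p-y⇒x≢y (F ∩ S) a∈′
    ... | inj₂ refl = w∈S , λ { refl → w∉F xo∈F }
    closed : Closed {graph} ((F - x o) ∪ ⁅ w ⁆) X
    closed a∈X e _ b∈ with ∈-∪⁅⁆⁻ (F - x o) b∈
    ... | inj₂ refl = y∈p∪⁅y⁆ _ w
    ... | inj₁ b∈F-x = let a∈S , a≢ = X⁻ a∈X in p⊆p∪q ⁅ w ⁆
      (x∈p∧x≢y⇒x∈p-y (x∈p∩q⁺ (p-x⊆p F (x o) b∈F-x , S-neighbour a∈S a≢ e)) (x∈p-y⇒x≢y F b∈F-x))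

  -- The new vertex can only join the component of x o, which has just lost u.
  exchange-for-star : ∀ {F u w} → Ind r graph F → x o ∈ F → Reach graph F (x o) u →
                      w ∈ S → w ∉ F → Ind r graph ((F - u) ∪ ⁅ w ⁆)
  exchange-for-star {F} {u} {w} ind xo∈F x⇝u w∈S w∉F =
    independent-exchange adj-sym ((K - u) ∪ ⁅ w ⁆) ind closed (y∈p∪⁅y⁆ _ w)
      (≤-trans (∣p-x∪⁅y⁆∣≤∣p∣ K w (∈-component⁺ adj? x⇝u)) (ind (x o) xo∈F K λ _ → ∈-component⁻ adj?))
    where
    K = component adj? F (x o)
    reaches : ∀ {a b} → a ∈ (K - u) ∪ ⁅ w ⁆ → Adj a b → b ∈ F → Reach graph F (x o) b
    reaches a∈X e b∈F with ∈-∪⁅⁆⁻ (K - u) a∈X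
    ... | inj₁ a∈K = reach-snoc (∈-component⁻ adj? (p-x⊆p K u a∈K)) e b∈F
    ... | inj₂ refl = S-reach xo∈F b∈F (S-neighbour w∈S (λ { refl → w∉F xo∈F }) e)
    closed : Closed {graph} ((F - u) ∪ ⁅ w ⁆) ((K - u) ∪ ⁅ w ⁆)
    closed a∈X e _ b∈ with ∈-∪⁅⁆⁻ (F - u) b∈
    ... | inj₂ refl = y∈p∪⁅y⁆ _ w
    ... | inj₁ b∈F-u = p⊆p∪q ⁅ w ⁆ (x∈p∧x≢y⇒x∈p-y
      (∈-component⁺ adj? (reaches a∈X e (p-x⊆p F u b∈F-u))) (x∈p-y⇒x≢y F b∈F-u))

  -- This covers both ends of the first phase: it is vacuous once `x o` is deleted, and otherwise
  -- says that only star vertices of the component are undecided.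
  Isolated : Subset N → Subset N → Set
  Isolated C H = ∀ v → Reach graph H (x o) v → x o ∈ C × (v ∈ C ⊎ v ∈ S)

  Stage : Subset N → Subset N → Set
  Stage C H = S ⊆ H ⊎ Isolated C H

  Step : Subset N → Subset N → Set
  Step C H = Ind r graph H ⊎
    ∃ λ u → u ∈ H × u ∉ C × Sheds (Ind r graph) C H u × Stage C (H - u) × Stage (C ∪ ⁅ u ⁆) H

  step-isolated : ∀ {C H} → C ⊆ H → Ind r graph C → Isolated C H → Step C H
  step-isolated {C} {H} C⊆H ind-C iso = proceed (r <? ∣ K ∣)
    where
    K = component adj? H (x o)
    attach : ∀ {u} → u ∈ H → u ∉ C → Sheds (Ind r graph) C H u → Step C H
    attach {u} u∈H u∉C sheds = inj₂ (u , u∈H , u∉C , sheds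
      -- Deletion can only shrink the component of `x o` and linking enlarges `C`, so isolation
      -- survives both.
      , inj₂ (λ v p → iso v (reach-mono (p-x⊆p H u) p))
      , inj₂ (λ v p → let x∈C , v∈ = iso v p in p⊆p∪q ⁅ u ⁆ x∈C , map₁ (p⊆p∪q ⁅ u ⁆) v∈))
    proceed : Dec (r < ∣ K ∣) → Step C H
    -- A component `K` of at most `r` vertices is set aside as the part around the root.
    proceed (no small) with BlockForest.next adj-sym adj? rootedBlocks r C⊆H ind-C
                             (λ a∈K e _ b∈H → ∈-component⁺ adj? (reach-snoc (∈-component⁻ adj? a∈K) e b∈H)) (≮⇒≥ small)
                             (λ x∈H → ∈-component⁺ adj? (here x∈H))
    ... | inj₁ ind-H = inj₁ ind-H
    ... | inj₂ (u , u∈H , u∉C , sheds) = attach u∈H u∉C sheds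
    proceed (yes big) = attach u∈H u∉C sheds
      where
      nonempty : ∃ λ v → v ∈ K
      nonempty with nonempty? K
      ... | yes v = v
      ... | no empty = contradiction
              (subst (r <_) (trans (cong ∣_∣ (Empty-unique empty)) (∣⊥∣≡0 N)) big) λ ()
      xo∈C : x o ∈ C
      xo∈C = proj₁ (iso _ (∈-component⁻ adj? (proj₂ nonempty)))
      -- `C ⊆ F` puts `x o` in `F`, so `K ⊆ F` would make all of `K` part of one component of `F`.
      K⊈face : ∀ {F} → C ⊆ F → Ind r graph F → ¬ K ⊆ F
      K⊈face {F} C⊆F ind K⊆F = <⇒≱ big (ind (x o) (C⊆F xo∈C) K λ v v∈K →
        proj₁ (reach-closed (λ v → Reach graph F (x o) v × Reach graph H (x o) v)
                (λ (p , q) e _ b∈H → let q′ = reach-snoc q e b∈H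
                                     in reach-snoc p e (K⊆F (∈-component⁺ adj? q′)) , q′)
                (here (C⊆F xo∈C) , here (C⊆H xo∈C)) (∈-component⁻ adj? v∈K)))
      missing : ∀ {F} → C ⊆ F → Ind r graph F → ∃ λ v → v ∈ H × v ∈ S × v ∉ F
      missing {F} C⊆F ind with ⊈⇒∃ K F (K⊈face C⊆F ind)
      ... | v , v∈K , v∉F with iso v (∈-component⁻ adj? v∈K)
      ...   | _ , inj₁ v∈C = contradiction (C⊆F v∈C) v∉F
      ...   | _ , inj₂ v∈S = v , reach-end (∈-component⁻ adj? v∈K) , v∈S , v∉F
      free = missing (λ v∈ → v∈) ind-C
      u = proj₁ free
      u∈H = proj₁ (proj₂ free)
      u∈S = proj₁ (proj₂ (proj₂ free))
      u∉C = proj₂ (proj₂ (proj₂ free))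
      sheds : Sheds (Ind r graph) C H u
      sheds F ind C⊆F F⊆H u∈F =
        let w , w∈H , w∈S , w∉F = missing C⊆F ind
        in w , w∈H , w∉F , exchange-for-star ind (C⊆F xo∈C) (S-reach (C⊆F xo∈C) u∈F u∈S) w∈S w∉F

  outside-star : ∀ {F H} → S ⊆ H → Ind r graph F → ∃ λ w → w ∈ H × w ∈ S × w ∉ F
  outside-star {F} S⊆H ind = let w , w∈S , w∉F = ⊈⇒∃ S F (S⊈face ind) in w , S⊆H w∈S , w∈S , w∉F

  next : ∀ {C H} → C ⊆ H → Ind r graph C → Stage C H → Step C H
  next C⊆H ind-C (inj₂ iso) = step-isolated C⊆H ind-C iso
  next {C} {H} C⊆H ind-C (inj₁ S⊆H) with x o ∈? C
  -- Deleting `x o` makes isolation vacuous; linking it keeps `S ⊆ H`.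
  ... | no xo∉C = inj₂ (x o , S⊆H xo∈S , xo∉C
        , (λ F ind _ _ xo∈F → let w , w∈H , w∈S , w∉F = outside-star S⊆H ind
                              in w , w∈H , w∉F , exchange-centre ind xo∈F w∈S w∉F)
        , inj₂ (λ v p → contradiction (reach-start p) (x∉p-x H))
        , inj₁ S⊆H)
  ... | yes xo∈C with any? (λ u → (u ∈? H) ×-dec ¬? (u ∈? C) ×-dec ¬? (u ∈? S) ×-dec
                            any? (λ c → reach? adj? C (x o) c ×-dec adj? c u))
  -- A face through `u` has it in the component of `x o`, so a missing star vertex can replace it;
  -- as `u` is outside `S`, deleting it keeps `S ⊆ H`.
  ...   | yes (u , u∈H , u∉C , u∉S , c , p , e) = inj₂ (u , u∈H , u∉C
          , (λ F ind C⊆F _ u∈F → let w , w∈H , w∈S , w∉F = outside-star S⊆H ind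
                                 in w , w∈H , w∉F , exchange-for-star ind (C⊆F xo∈C)
                                      (reach-snoc (reach-mono C⊆F p) e u∈F) w∈S w∉F)
          , inj₁ (⊆∧∌⇒⊆- S⊆H u∉S)
          , inj₁ S⊆H)
  -- With no such `u` left, walks from `x o` in `H` never leave the linked component together with
  -- `S`.
  ...   | no ∄ = step-isolated C⊆H ind-C λ v p → xo∈C
          , map₁ reach-end (reach-closed (λ v → Reach graph C (x o) v ⊎ v ∈ S) spread (inj₂ xo∈S) p)
    where
    from-C : ∀ {a b} → Reach graph C (x o) a → Adj a b → b ∈ H → Reach graph C (x o) b ⊎ b ∈ S
    from-C {a} {b} p e b∈H with b ∈? C | b ∈? S
    ... | yes b∈C | _ = inj₁ (reach-snoc p e b∈C)
    ... | no _ | yes b∈S = inj₂ b∈S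
    ... | no b∉C | no b∉S = contradiction (b , b∈H , b∉C , b∉S , a , p , e) ∄
    spread : ∀ {a b} → Reach graph C (x o) a ⊎ a ∈ S → Adj a b → a ∈ H → b ∈ H →
             Reach graph C (x o) b ⊎ b ∈ S
    spread (inj₁ p) e _ b∈H = from-C p e b∈H
    spread {a} (inj₂ a∈S) e _ b∈H with a ≟ x o
    ... | yes refl = from-C (here xo∈C) e b∈H
    ... | no a≢ = inj₂ (S-neighbour a∈S a≢ e)

theorem5p5 : (r : ℕ) → 1 ≤ r → (D : GrData r) → Shellable (Ind r (GrData.graph D))
theorem5p5 r _ D = decomposition⇒shellable (decompose Stage next (GrData.N D)
    (≤-trans (∣p∣≤n (⊤ {GrData.N D})) (m≤m+n _ _)) ⊥⊆ (inj₁ ⊆⊤))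
  where
  open CliqueCycle D
  open Shedding (Ind r (GrData.graph D)) (independent? adj? r) independent-⊆
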